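{- Let $G$ be a polygon circle graph with clique number $\omega$. Then the chromatic number of $G$ is at most $7\omega^4$.
   Context: A polygon circle graph is the intersection graph of a finite set of polygons inscribed in the unit circle: the vertices are the polygons (convex polygonal regions all of whose corners lie on the unit circle), and two distinct vertices are adjacent if and only if the corresponding polygons intersect. -}

module Defs where

open import Algebra.Apartness.Bundles using (HeytingField; HeytingCommutativeRing)
open import Algebra.Bundles using (CommutativeRing)
import Algebra.Definitions.RawMonoid as RawMonoidDefinitions
open import Data.Fin.Base using (Fin)
open import Data.Fin.Subset using (Subset; _∈_; ∣_∣)
open import Data.Nat.Base as ℕ using (ℕ)
open import Data.Product.Base using (Σ-syntax; ∃-syntax; _×_; _,_; proj₁; proj₂)
open import Data.Sum.Base using (_⊎_)
open import Data.Vec.Functional using (Vector)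
open import Function.Base using (_∘_)
open import Function.Bundles using (_⇔_)
open import Function.Definitions using (Injective)
open import Level using (Level; _⊔_; suc)
open import Relation.Binary.Core using (Rel)
open import Relation.Binary.Definitions using (Irreflexive; Symmetric)
open import Relation.Binary.PropositionalEquality.Core using (_≡_; _≢_)
open import Relation.Binary.Structures using (IsStrictPartialOrder)
open import Relation.Nullary.Negation.Core using (¬_)
open import Relation.Unary using (Pred; _≐_; _∩_; Satisfiable)

-- The real numbers, given axiomatically as a Cauchy-complete Archimedean
-- ordered field (classically unique up to isomorphism).  The order is not
-- assumed decidable, so that constructive real numbers are a model too.
-- Tightness of _<_, its cotransitivity and 0 < 1 follow from the Heyting
-- field structure and #⇔<⊎>.
record RealNumbers (c ℓ₁ ℓ₂ : Level) : Set (suc (c ⊔ ℓ₁ ⊔ ℓ₂)) where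
  field
    heytingField : HeytingField c ℓ₁ ℓ₂

  open HeytingField heytingField public
  open CommutativeRing (HeytingCommutativeRing.commutativeRing heytingCommutativeRing) public
    using (+-rawMonoid)
  open RawMonoidDefinitions +-rawMonoid public
    using (sum) renaming (_×_ to _·_)

  infix 4 _<_ _≤_

  field
    _<_                  : Rel Carrier ℓ₂
    isStrictPartialOrder : IsStrictPartialOrder _≈_ _<_
    #⇔<⊎>                : ∀ x y → (x # y) ⇔ (x < y ⊎ y < x)
    +-monoˡ-<            : ∀ z {x y} → x < y → x + z < y + z
    *-pos                : ∀ {x y} → 0# < x → 0# < y → 0# < x * y
    archimedean          : ∀ x → ∃[ n ] x < n · 1#

  _≤_ : Rel Carrier ℓ₂
  x ≤ y = ¬ (y < x)

  -- As m and n range independently, s m - s n < ε bounds ∣ s m - s n ∣.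
  IsCauchy : (ℕ → Carrier) → Set (c ⊔ ℓ₂)
  IsCauchy s = ∀ ε → 0# < ε →
    ∃[ N ] (∀ m n → N ℕ.≤ m → N ℕ.≤ n → s m - s n < ε)

  _ConvergesTo_ : (ℕ → Carrier) → Carrier → Set (c ⊔ ℓ₂)
  s ConvergesTo l = ∀ ε → 0# < ε →
    ∃[ N ] (∀ n → N ℕ.≤ n → s n - l < ε × l - s n < ε)

  field
    complete : ∀ s → IsCauchy s → ∃[ l ] s ConvergesTo l

module Plane {c ℓ₁ ℓ₂} (ℝ : RealNumbers c ℓ₁ ℓ₂) where
  open RealNumbers ℝ

  Point : Set c
  Point = Carrier × Carrier

  infix 4 _≈ₚ_

  _≈ₚ_ : Rel Point ℓ₁
  (x , y) ≈ₚ (x′ , y′) = x ≈ x′ × y ≈ y′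

  OnUnitCircle : Pred Point ℓ₁
  OnUnitCircle (x , y) = x * x + y * y ≈ 1#

  combination : ∀ {k} → Vector Carrier k → Vector Point k → Point
  combination w p =
    sum (λ i → w i * proj₁ (p i)) ,
    sum (λ i → w i * proj₂ (p i))

  ConvexHull : ∀ {k} → Vector Point k → Pred Point (c ⊔ ℓ₁ ⊔ ℓ₂)
  ConvexHull {k} p q = Σ[ w ∈ Vector Carrier k ]
    (∀ i → 0# ≤ w i) × sum w ≈ 1# × q ≈ₚ combination w p

  -- Points of the circle are in convex position, so the corners of the hull
  -- are exactly the given points; their order does not matter.
  record InscribedPolygon : Set (c ⊔ ℓ₁ ⊔ ℓ₂) where
    field
      size     : ℕ
      size≥3   : 3 ℕ.≤ size
      corner   : Vector Point size
      distinct : Injective _≡_ _≈ₚ_ corner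
      onCircle : ∀ i → OnUnitCircle (corner i)

    region : Pred Point (c ⊔ ℓ₁ ⊔ ℓ₂)
    region = ConvexHull corner

  open InscribedPolygon public using (region)

  Intersect : Rel InscribedPolygon (c ⊔ ℓ₁ ⊔ ℓ₂)
  Intersect P Q = Satisfiable (region P ∩ region Q)

record Graph (n : ℕ) (a : Level) : Set (suc a) where
  field
    Adjacent    : Rel (Fin n) a
    symmetric   : Symmetric Adjacent
    irreflexive : Irreflexive _≡_ Adjacent

module _ {n : ℕ} {a : Level} (G : Graph n a) where
  open Graph G

  IsClique : Subset n → Set a
  IsClique S = ∀ {u v} → u ∈ S → v ∈ S → u ≢ v → Adjacent u v

  IsCliqueNumber : ℕ → Set a
  IsCliqueNumber ω =
    (∃[ S ] IsClique S × ∣ S ∣ ≡ ω) × (∀ S → IsClique S → ∣ S ∣ ℕ.≤ ω)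

  Colourable : ℕ → Set a
  Colourable k = Σ[ f ∈ (Fin n → Fin k) ] (∀ {u v} → Adjacent u v → f u ≢ f v)

  IsChromaticNumber : ℕ → Set a
  IsChromaticNumber χ = Colourable χ × (∀ k → Colourable k → χ ℕ.≤ k)

  -- `distinct` says that the polygons form a set, rather than a family with
  -- repetitions.
  record IsPolygonCircleGraph {c ℓ₁ ℓ₂} (ℝ : RealNumbers c ℓ₁ ℓ₂)
         : Set (a ⊔ c ⊔ ℓ₁ ⊔ ℓ₂) where
    open Plane ℝ
    field
      polygon  : Fin n → InscribedPolygon
      distinct : Injective _≡_ _≐_ (region ∘ polygon)
      adjacent : ∀ {u v} → u ≢ v → Adjacent u v ⇔ Intersect (polygon u) (polygon v)

{-# OPTIONS --safe #-}

-- Cut the circle, so that every polygon becomes a finite set of positions on a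
-- line; two polygons meet iff these sets share a position or alternate.  Insert
-- pillars between positions one after another and assign each polygon to the
-- first pillar inside its hull interval.  Polygons with a common pillar are
-- coloured with ω³ colours: two of them are adjacent only if the parts to the
-- left of the pillar overlap, or those to the right do, or one lies strictly to
-- the right of the other, and each of these relations is ω-colourable.
--
-- It remains to give the pillars 7ω classes so that a polygon never meets one
-- of the same class that belongs to another pillar.  Two polygons of different
-- pillars that reach into the same segment from outside meet as soon as their
-- corners in the segment are in the right order, so in the incidence matrix of k
-- consecutive pieces of a segment against the d pillars seen from it, every
-- antidiagonal has at most ω ones.  Hence a segment that sees at most 5ω pillars
-- has fewer than 3ω disjoint pieces that see more than 3ω of them.  Cutting the
-- segment into such pieces by a balanced tree of at most 4^ω pillars lets each
-- piece see at most 2ω new pillars, so that it again sees at most 5ω.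
module Submission where

open import Defs

open import Algebra.Apartness.Bundles using (HeytingCommutativeRing)
open import Algebra.Bundles using (CommutativeRing)
open import Algebra.Solver.Ring.AlmostCommutativeRing
  using (fromCommutativeRing; _-Raw-AlmostCommutative⟶_; Induced-equivalence)
import Algebra.Solver.Ring as RingSolver
open import Data.Fin.Base using (Fin; zero; suc; toℕ; fromℕ<; combine)
import Data.Fin.Properties as Fin
open import Data.Fin.Subset as Subset using (Subset; ⁅_⁆; ∣_∣; _∪_)
import Data.Fin.Subset.Properties as Subset
open import Data.Integer.Base as ℤ using (ℤ; -[1+_]; _⊖_; +-*-rawRing)
import Data.Integer.Properties as ℤ
import Data.Maybe.Base as Maybe
open import Data.Nat.Base as ℕ using (ℕ; zero; suc)
import Data.Nat.Properties as ℕ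
open import Data.Product.Base using (∃-syntax; Σ-syntax; _×_; _,_; proj₁; proj₂)
open import Data.Sum.Base using (_⊎_; inj₁; inj₂; [_,_]′; swap)
open import Data.Vec.Functional using (Vector)
open import Function.Base using (_∘_; id; flip; case_of_; _∋_)
open import Function.Bundles using (module Equivalence)
open import Level using (Level; 0ℓ; _⊔_)
open import Relation.Binary.Bundles using (DecTotalOrder)
open import Relation.Binary.Consequences using (dec⇒weaklyDec)
open import Relation.Binary.Core using (Rel; REL)
open import Relation.Binary.Definitions
  using (DecidableEquality; Irreflexive; Symmetric; Transitive; WeaklyDecidable; _Respectsʳ_; tri<; tri≈; tri>)
  renaming (Decidable to Decidable₂)
open import Relation.Binary.PropositionalEquality.Core as ≡ using (_≡_)
open import Relation.Binary.Structures using (IsStrictPartialOrder)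
open import Relation.Nullary.Decidable.Core using (Dec; yes; no; _×-dec_; _⊎-dec_; decidable-stable)
open import Relation.Nullary.Negation.Core using (¬_; contradiction)
open import Relation.Unary using (Pred; Decidable)

-- Geometry of the circle

-- Equality in the ring need not be decidable, so the solver takes integer coefficients. With the
-- optimised multiples `n ⋆ 1#`, `con (+ 1)` and `con (+ 2)` evaluate to `1#` and `1# + 1#`
-- themselves.
module ℤSolver {c ℓ} (R : CommutativeRing c ℓ) where
  open CommutativeRing R
  open import Data.Integer.Base using (+_)
  open import Algebra.Properties.Ring ring
    using (-0#≈0#; -‿distribˡ-*; -‿involutive; -‿+-comm)
  open import Algebra.Properties.Semiring.Mult.TCOptimised semiring
    using (1+×; ×-homo-+; ×1-homo-*) renaming (_×_ to _⋆_)
  open import Relation.Binary.Reasoning.Setoid setoid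

  private
    ⟦_⟧ : ℤ → Carrier
    ⟦ + n      ⟧ = n ⋆ 1#
    ⟦ -[1+ n ] ⟧ = - (suc n ⋆ 1#)

    ⊖-homo : ∀ m n → ⟦ m ⊖ n ⟧ ≈ m ⋆ 1# - n ⋆ 1#
    ⊖-homo m zero = begin
      m ⋆ 1#          ≈⟨ +-identityʳ _ ⟨
      m ⋆ 1# + 0#     ≈⟨ +-congˡ -0#≈0# ⟨
      m ⋆ 1# - 0#     ∎
    ⊖-homo zero (suc n) = sym (+-identityˡ _)
    ⊖-homo (suc m) (suc n) = begin
      ⟦ suc m ⊖ suc n ⟧                     ≡⟨ ≡.cong ⟦_⟧ (ℤ.[1+m]⊖[1+n]≡m⊖n m n) ⟩
      ⟦ m ⊖ n ⟧                             ≈⟨ ⊖-homo m n ⟩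
      m ⋆ 1# - n ⋆ 1#                       ≈⟨ +-identityˡ _ ⟨
      0# + (m ⋆ 1# - n ⋆ 1#)                ≈⟨ +-congʳ (-‿inverseʳ 1#) ⟨
      (1# - 1#) + (m ⋆ 1# - n ⋆ 1#)         ≈⟨ interchange 1# (- 1#) (m ⋆ 1#) (- (n ⋆ 1#)) ⟩
      (1# + m ⋆ 1#) + (- 1# + - (n ⋆ 1#))   ≈⟨ +-congˡ (-‿+-comm 1# (n ⋆ 1#)) ⟩
      (1# + m ⋆ 1#) - (1# + n ⋆ 1#)         ≈⟨ +-cong (1+× m 1#) (-‿cong (1+× n 1#)) ⟨
      suc m ⋆ 1# - suc n ⋆ 1#               ∎
      where open import Algebra.Properties.CommutativeSemigroup +-commutativeSemigroup using (interchange)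

    -‿homo : ∀ i → ⟦ ℤ.- i ⟧ ≈ - ⟦ i ⟧
    -‿homo (+ zero)  = sym -0#≈0#
    -‿homo (+ suc n) = refl
    -‿homo -[1+ n ]  = sym (-‿involutive _)

    +-homo : ∀ i j → ⟦ i ℤ.+ j ⟧ ≈ ⟦ i ⟧ + ⟦ j ⟧
    +-homo (+ m)      (+ n)      = ×-homo-+ 1# m n
    +-homo (+ m)      -[1+ n ]   = ⊖-homo m (suc n)
    +-homo -[1+ m ]   (+ n)      = trans (⊖-homo n (suc m)) (+-comm _ _)
    +-homo -[1+ m ]   -[1+ n ]   = begin
      - (suc (suc (m ℕ.+ n)) ⋆ 1#)          ≡⟨ ≡.cong (λ k → - (suc k ⋆ 1#)) (ℕ.+-suc m n) ⟨
      - ((suc m ℕ.+ suc n) ⋆ 1#)            ≈⟨ -‿cong (×-homo-+ 1# (suc m) (suc n)) ⟩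
      - (suc m ⋆ 1# + suc n ⋆ 1#)           ≈⟨ -‿+-comm _ _ ⟨
      - (suc m ⋆ 1#) + - (suc n ⋆ 1#)       ∎

    *-homo⁺ : ∀ m j → ⟦ + m ℤ.* j ⟧ ≈ ⟦ + m ⟧ * ⟦ j ⟧
    *-homo⁺ m (+ n)    = begin
      ⟦ + m ℤ.* + n ⟧      ≡⟨ ≡.cong ⟦_⟧ (ℤ.pos-* m n) ⟨
      (m ℕ.* n) ⋆ 1#       ≈⟨ ×1-homo-* m n ⟩
      m ⋆ 1# * (n ⋆ 1#)    ∎
    *-homo⁺ m -[1+ n ] = begin
      ⟦ + m ℤ.* -[1+ n ] ⟧         ≡⟨ ≡.cong ⟦_⟧ (ℤ.neg-distribʳ-* (+ m) (+ suc n)) ⟨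
      ⟦ ℤ.- (+ m ℤ.* + suc n) ⟧    ≈⟨ -‿homo (+ m ℤ.* + suc n) ⟩
      - ⟦ + m ℤ.* + suc n ⟧        ≈⟨ -‿cong (*-homo⁺ m (+ suc n)) ⟩
      - (m ⋆ 1# * (suc n ⋆ 1#))    ≈⟨ -‿distribʳ-* _ _ ⟩
      m ⋆ 1# * - (suc n ⋆ 1#)      ∎
      where open import Algebra.Properties.Ring ring using (-‿distribʳ-*)

    *-homo : ∀ i j → ⟦ i ℤ.* j ⟧ ≈ ⟦ i ⟧ * ⟦ j ⟧
    *-homo (+ m)    j = *-homo⁺ m j
    *-homo -[1+ m ] j = begin
      ⟦ -[1+ m ] ℤ.* j ⟧           ≡⟨ ≡.cong ⟦_⟧ (ℤ.neg-distribˡ-* (+ suc m) j) ⟨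
      ⟦ ℤ.- (+ suc m ℤ.* j) ⟧      ≈⟨ -‿homo (+ suc m ℤ.* j) ⟩
      - ⟦ + suc m ℤ.* j ⟧          ≈⟨ -‿cong (*-homo⁺ (suc m) j) ⟩
      - (suc m ⋆ 1# * ⟦ j ⟧)       ≈⟨ -‿distribˡ-* _ _ ⟩
      - (suc m ⋆ 1#) * ⟦ j ⟧       ∎

    ℤ⟶R : +-*-rawRing -Raw-AlmostCommutative⟶ fromCommutativeRing R
    ℤ⟶R = record
      { ⟦_⟧    = ⟦_⟧
      ; +-homo = +-homo
      ; *-homo = *-homo
      ; -‿homo = -‿homo
      ; 0-homo = refl
      ; 1-homo = refl
      }

    _≟_ : WeaklyDecidable (Induced-equivalence ℤ⟶R)
    i ≟ j = Maybe.map (λ { ≡.refl → refl }) (dec⇒weaklyDec ℤ._≟_ i j)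

  open RingSolver +-*-rawRing (fromCommutativeRing R) ℤ⟶R _≟_ public
    using (Polynomial; con; solve; _:=_; _:+_; _:*_; _:-_; :-_)

-- Arithmetic of an ordered field whose order need not be decidable

module OrderedField {c ℓ₁ ℓ₂} (ℝ : RealNumbers c ℓ₁ ℓ₂) where
  open RealNumbers ℝ hiding (zero)
  open import Data.Integer.Base using (+_)
  open IsStrictPartialOrder isStrictPartialOrder public
    using (<-respʳ-≈; <-respˡ-≈) renaming (irrefl to <-irrefl; trans to <-trans; asym to <-asym)

  commutativeRing : CommutativeRing c ℓ₁
  commutativeRing = HeytingCommutativeRing.commutativeRing heytingCommutativeRing

  open ℤSolver commutativeRing public

  2# : Carrier
  2# = 1# + 1#

  -- If both strict alternatives are refuted, the elements are not apart, and tightness makes them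
  -- equal. The double negation is harmless wherever the goal is itself a negation.
  trichotomy : ∀ x y → ¬ ¬ (x < y ⊎ x ≈ y ⊎ y < x)
  trichotomy x y k = k (inj₂ (inj₁ (proj₁ (tight x y) λ x#y →
    k (case Equivalence.to (#⇔<⊎> x y) x#y of λ where
      (inj₁ x<y) → inj₁ x<y
      (inj₂ y<x) → inj₂ (inj₂ y<x)))))

  <-resp-≈₂ : ∀ {w x y z} → w ≈ x → y ≈ z → w < y → x < z
  <-resp-≈₂ w≈x y≈z = <-respʳ-≈ y≈z ∘ <-respˡ-≈ w≈x

  x<y⇒0<y-x : ∀ {x y} → x < y → 0# < y - x
  x<y⇒0<y-x {x} x<y = <-respˡ-≈ (-‿inverseʳ x) (+-monoˡ-< (- x) x<y)

  0<y-x⇒x<y : ∀ {x y} → 0# < y - x → x < y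
  0<y-x⇒x<y {x} {y} 0< = <-resp-≈₂ (+-identityˡ x)
    (solve 2 (λ x y → (y :- x) :+ x := y) refl x y) (+-monoˡ-< x 0<)

  x<0⇒0<-x : ∀ {x} → x < 0# → 0# < - x
  x<0⇒0<-x {x} x<0 = <-respʳ-≈ (+-identityˡ (- x)) (x<y⇒0<y-x x<0)

  0<-x⇒x<0 : ∀ {x} → 0# < - x → x < 0#
  0<-x⇒x<0 {x} 0<-x = 0<y-x⇒x<y (<-respʳ-≈ (sym (+-identityˡ (- x))) 0<-x)

  +-pos : ∀ {x y} → 0# < x → 0# < y → 0# < x + y
  +-pos {x} {y} 0<x 0<y = <-trans 0<y (<-respˡ-≈ (+-identityˡ y) (+-monoˡ-< y 0<x))

  *-neg : ∀ {x y} → x < 0# → y < 0# → 0# < x * y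
  *-neg {x} {y} x<0 y<0 = <-respʳ-≈ (solve 2 (λ x y → (:- x) :* (:- y) := x :* y) refl x y)
    (*-pos (x<0⇒0<-x x<0) (x<0⇒0<-x y<0))

  *-pos-neg : ∀ {x y} → 0# < x → y < 0# → x * y < 0#
  *-pos-neg {x} {y} 0<x y<0 = 0<y-x⇒x<y (<-respʳ-≈
    (solve 2 (λ x y → x :* (:- y) := con (+ 0) :- x :* y) refl x y) (*-pos 0<x (x<0⇒0<-x y<0)))

  1#0 : 1# # 0#
  1#0 = invertible⇒# (1# ,
    solve 0 (con (+ 1) :* (con (+ 1) :- con (+ 0)) := con (+ 1)) refl ,
    solve 0 ((con (+ 1) :- con (+ 0)) :* con (+ 1) := con (+ 1)) refl)

  0<1 : 0# < 1#
  0<1 with Equivalence.to (#⇔<⊎> 1# 0#) 1#0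
  ... | inj₂ 0<1 = 0<1
  ... | inj₁ 1<0 = <-respʳ-≈ (*-identityˡ 1#) (*-neg 1<0 1<0)

  0<2 : 0# < 2#
  0<2 = +-pos 0<1 0<1

  0≤1 : 0# ≤ 1#
  0≤1 = <-asym 0<1

  square-≮0 : ∀ x → ¬ x * x < 0#
  square-≮0 x x²<0 = trichotomy x 0# λ where
    (inj₁ x<0)        → <-asym x²<0 (*-neg x<0 x<0)
    (inj₂ (inj₁ x≈0)) → <-irrefl (trans (*-congʳ x≈0) (zeroˡ x)) x²<0
    (inj₂ (inj₂ 0<x)) → <-asym x²<0 (*-pos 0<x 0<x)

  square≈0 : ∀ {x} → x * x ≈ 0# → x ≈ 0#
  square≈0 {x} x²≈0 = proj₁ (tight x 0#) λ x#0 →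
    case Equivalence.to (#⇔<⊎> x 0#) x#0 of λ where
      (inj₁ x<0) → <-irrefl (sym x²≈0) (*-neg x<0 x<0)
      (inj₂ 0<x) → <-irrefl (sym x²≈0) (*-pos 0<x 0<x)

  inverse : ∀ {x} → 0# < x → ∃[ x⁻¹ ] x⁻¹ * x ≈ 1#
  inverse {x} 0<x with x⁻¹ , eq , _ ← #⇒invertible (Equivalence.from (#⇔<⊎> x 0#) (inj₂ 0<x)) =
    x⁻¹ , trans (solve 2 (λ x y → y :* x := y :* (x :- con (+ 0))) refl x x⁻¹) eq

  -- A factor of a positive product is invertible, hence apart from 0.
  *-cancelˡ-pos : ∀ {x y} → 0# < x → 0# < x * y → 0# < y
  *-cancelˡ-pos {x} {y} 0<x 0<xy with z , z*xy≈1 ← inverse 0<xy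
    with Equivalence.to (#⇔<⊎> y 0#) (invertible⇒# (z * x ,
      trans (solve 3 (λ x y z → z :* x :* (y :- con (+ 0)) := z :* (x :* y)) refl x y z) z*xy≈1 ,
      trans (solve 3 (λ x y z → (y :- con (+ 0)) :* (z :* x) := z :* (x :* y)) refl x y z) z*xy≈1))
  ... | inj₁ y<0 = contradiction (*-pos-neg 0<x y<0) (<-asym 0<xy)
  ... | inj₂ 0<y = 0<y

  *-cancelˡ : ∀ {x y z} → 0# < x → x * y ≈ x * z → y ≈ z
  *-cancelˡ {x} {y} {z} 0<x eq with x⁻¹ , x⁻¹x≈1 ← inverse 0<x = trans (sym (undo y)) (trans (*-congˡ eq) (undo z))
    where
    undo : ∀ y → x⁻¹ * (x * y) ≈ y
    undo y = trans (sym (*-assoc x⁻¹ x y)) (trans (*-congʳ x⁻¹x≈1) (*-identityˡ y))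

  +-nonneg : ∀ {x y} → 0# ≤ x → 0# ≤ y → 0# ≤ x + y
  +-nonneg {x} {y} 0≤x 0≤y x+y<0 = trichotomy x 0# λ where
    (inj₁ x<0)        → 0≤x x<0
    (inj₂ (inj₁ x≈0)) → 0≤y (<-respˡ-≈ (trans (+-congʳ x≈0) (+-identityˡ y)) x+y<0)
    (inj₂ (inj₂ 0<x)) → 0≤y (<-trans (<-respˡ-≈ (+-identityˡ y) (+-monoˡ-< y 0<x)) x+y<0)

  +-pos-nonneg : ∀ {x y} → 0# < x → 0# ≤ y → ¬ ¬ (0# < x + y)
  +-pos-nonneg {x} {y} 0<x 0≤y k = trichotomy y 0# λ where
    (inj₁ y<0)        → 0≤y y<0
    (inj₂ (inj₁ y≈0)) → k (<-respʳ-≈ (sym (trans (+-congˡ y≈0) (+-identityʳ x))) 0<x)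
    (inj₂ (inj₂ 0<y)) → k (+-pos 0<x 0<y)

  *-nonneg : ∀ {x y} → 0# ≤ x → 0# ≤ y → 0# ≤ x * y
  *-nonneg {x} {y} 0≤x 0≤y xy<0 = trichotomy x 0# λ where
    (inj₁ x<0)        → 0≤x x<0
    (inj₂ (inj₁ x≈0)) → <-irrefl (trans (*-congʳ x≈0) (zeroˡ y)) xy<0
    (inj₂ (inj₂ 0<x)) → trichotomy y 0# λ where
      (inj₁ y<0)        → 0≤y y<0
      (inj₂ (inj₁ y≈0)) → <-irrefl (trans (*-congˡ y≈0) (zeroʳ x)) xy<0
      (inj₂ (inj₂ 0<y)) → <-asym xy<0 (*-pos 0<x 0<y)

  sum-nonneg : ∀ {k} {f : Vector Carrier k} → (∀ i → 0# ≤ f i) → 0# ≤ sum f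
  sum-nonneg {zero}  0≤f = <-irrefl refl
  sum-nonneg {suc k} 0≤f = +-nonneg (0≤f zero) (sum-nonneg (0≤f ∘ suc))

  -- Some weight is positive, but which one cannot be decided. If the weights of the tail sum to
  -- zero, the head has positive weight; if they sum to a positive number, induction applies to the
  -- tail.
  weighted-sum-pos : ∀ {k} {w f : Vector Carrier k} → (∀ i → 0# ≤ w i) → (∀ i → 0# < f i) →
    0# < sum w → ¬ ¬ (0# < sum (λ i → w i * f i))
  weighted-sum-pos {zero}          _   _   0<0 _ = <-irrefl refl 0<0
  weighted-sum-pos {suc k} {w} {f} 0≤w 0<f 0<Σ ¬goal = trichotomy (sum (w ∘ suc)) 0# λ where
    (inj₁ Σ′<0)        → sum-nonneg (0≤w ∘ suc) Σ′<0
    (inj₂ (inj₁ Σ′≈0)) → +-pos-nonneg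
      (*-pos (<-respʳ-≈ (trans (+-congˡ Σ′≈0) (+-identityʳ (w zero))) 0<Σ) (0<f zero))
      (sum-nonneg (λ i → *-nonneg (0≤w (suc i)) (<-asym (0<f (suc i))))) ¬goal
    (inj₂ (inj₂ 0<Σ′)) → weighted-sum-pos (0≤w ∘ suc) (0<f ∘ suc) 0<Σ′ λ 0<Σ′f →
      +-pos-nonneg 0<Σ′f (*-nonneg (0≤w zero) (<-asym (0<f zero))) (¬goal ∘ <-respʳ-≈ (+-comm _ _))

  sum-cong : ∀ {k} {f g : Vector Carrier k} → (∀ i → f i ≈ g i) → sum f ≈ sum g
  sum-cong {zero}  eq = refl
  sum-cong {suc k} eq = +-cong (eq zero) (sum-cong (eq ∘ suc))

  sum-linear : ∀ {k} a b (f g : Vector Carrier k) →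
    sum (λ i → a * f i + b * g i) ≈ a * sum f + b * sum g
  sum-linear {zero}  a b f g = solve 2 (λ a b → con (+ 0) := a :* con (+ 0) :+ b :* con (+ 0)) refl a b
  sum-linear {suc k} a b f g = trans (+-congˡ (sum-linear a b (f ∘ suc) (g ∘ suc)))
    (solve 6 (λ a b f g s t → a :* f :+ b :* g :+ (a :* s :+ b :* t) := a :* (f :+ s) :+ b :* (g :+ t))
      refl a b (f zero) (g zero) (sum (f ∘ suc)) (sum (g ∘ suc)))

  -- The Kronecker delta: the weights of a combination concentrated on one corner.
  δ : ∀ {k} → Fin k → Vector Carrier k
  δ zero    zero    = 1#
  δ zero    (suc _) = 0#
  δ (suc i) zero    = 0#
  δ (suc i) (suc j) = δ i j

  δ-nonneg : ∀ {k} (i j : Fin k) → 0# ≤ δ i j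
  δ-nonneg zero    zero    = 0≤1
  δ-nonneg zero    (suc _) = <-irrefl refl
  δ-nonneg (suc i) zero    = <-irrefl refl
  δ-nonneg (suc i) (suc j) = δ-nonneg i j

  sum-zero : ∀ {k} (f : Vector Carrier k) → sum (λ i → 0# * f i) ≈ 0#
  sum-zero {zero}  f = refl
  sum-zero {suc k} f = trans (+-cong (zeroˡ (f zero)) (sum-zero (f ∘ suc))) (+-identityˡ 0#)

  sum-δ : ∀ {k} (i : Fin k) (f : Vector Carrier k) → sum (λ j → δ i j * f j) ≈ f i
  sum-δ zero    f = trans (+-cong (*-identityˡ (f zero)) (sum-zero (f ∘ suc))) (+-identityʳ (f zero))
  sum-δ (suc i) f = trans (+-cong (zeroˡ (f zero)) (sum-δ i (f ∘ suc))) (+-identityˡ (f (suc i)))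

-- Orientation of triangles and intersection of convex hulls

module CircleGeometry {c ℓ₁ ℓ₂} (ℝ : RealNumbers c ℓ₁ ℓ₂) where
  open RealNumbers ℝ hiding (zero)
  open import Data.Integer.Base using (+_)
  open Plane ℝ
  open OrderedField ℝ

  -- Twice the signed area of a triangle, positive when its points run counterclockwise.
  orient : Point → Point → Point → Carrier
  orient (ax , ay) (bx , by) (cx , cy) = (bx - ax) * (cy - ay) - (by - ay) * (cx - ax)

  private
    orientₛ : ∀ {n} (ax ay bx by cx cy : Polynomial n) → Polynomial n
    orientₛ ax ay bx by cx cy = (bx :- ax) :* (cy :- ay) :- (by :- ay) :* (cx :- ax)

  orient-cong : ∀ {a a′ b b′ d d′} → a ≈ₚ a′ → b ≈ₚ b′ → d ≈ₚ d′ → orient a b d ≈ orient a′ b′ d′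
  orient-cong (ax , ay) (bx , by) (dx , dy) =
    +-cong (*-cong (+-cong bx (-‿cong ax)) (+-cong dy (-‿cong ay)))
      (-‿cong (*-cong (+-cong by (-‿cong ay)) (+-cong dx (-‿cong ax))))

  orient-cycle : ∀ a b d → orient a b d ≈ orient b d a
  orient-cycle (ax , ay) (bx , by) (dx , dy) = solve 6 (λ ax ay bx by dx dy →
    orientₛ ax ay bx by dx dy := orientₛ bx by dx dy ax ay) refl ax ay bx by dx dy

  orient-swap : ∀ a b d → orient a b d ≈ - orient a d b
  orient-swap (ax , ay) (bx , by) (dx , dy) = solve 6 (λ ax ay bx by dx dy →
    orientₛ ax ay bx by dx dy := :- orientₛ ax ay dx dy bx by) refl ax ay bx by dx dy

  orient-repeat : ∀ a b → orient a b a ≈ 0#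
  orient-repeat (ax , ay) (bx , by) = solve 4 (λ ax ay bx by →
    orientₛ ax ay bx by ax ay := con (+ 0)) refl ax ay bx by

  -- With two points fixed the orientation is an affine function of the third, and affine functions
  -- commute with combinations whose weights sum to one.
  orient-combination : ∀ a b {k} (w : Vector Carrier k) p → sum w ≈ 1# →
    sum (λ i → w i * orient a b (p i)) ≈ orient a b (combination w p)
  orient-combination (ax , ay) (bx , by) w p Σw≈1 = begin
    sum (λ i → w i * orient (ax , ay) (bx , by) (p i))
      ≈⟨ sum-cong (λ i → solve 7 (λ ax ay bx by px py w →
           w :* orientₛ ax ay bx by px py :=
           con (+ 1) :* ((bx :- ax) :* (w :* py) :+ (:- (by :- ay)) :* (w :* px)) :+
           ((by :- ay) :* ax :- (bx :- ax) :* ay) :* w)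
           refl ax ay bx by (proj₁ (p i)) (proj₂ (p i)) (w i)) ⟩
    sum (λ i → 1# * ((bx - ax) * (w i * proj₂ (p i)) + (- (by - ay)) * (w i * proj₁ (p i))) + γ * w i)
      ≈⟨ sum-linear 1# γ (λ i → (bx - ax) * (w i * proj₂ (p i)) + (- (by - ay)) * (w i * proj₁ (p i))) w ⟩
    1# * sum (λ i → (bx - ax) * (w i * proj₂ (p i)) + (- (by - ay)) * (w i * proj₁ (p i))) + γ * sum w
      ≈⟨ +-cong (*-congˡ (sum-linear (bx - ax) (- (by - ay)) (λ i → w i * proj₂ (p i)) (λ i → w i * proj₁ (p i)))) (*-congˡ Σw≈1) ⟩
    1# * ((bx - ax) * Σy + (- (by - ay)) * Σx) + γ * 1#
      ≈⟨ solve 6 (λ ax ay bx by x y →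
           con (+ 1) :* ((bx :- ax) :* y :+ (:- (by :- ay)) :* x) :+
           ((by :- ay) :* ax :- (bx :- ax) :* ay) :* con (+ 1) := orientₛ ax ay bx by x y)
           refl ax ay bx by Σx Σy ⟩
    orient (ax , ay) (bx , by) (Σx , Σy) ∎
    where
    open import Relation.Binary.Reasoning.Setoid (CommutativeRing.setoid commutativeRing)
    γ = (by - ay) * ax - (bx - ax) * ay
    Σx = sum (λ i → w i * proj₁ (p i))
    Σy = sum (λ i → w i * proj₂ (p i))

  -- The line through `a` and `b` separates the hulls: at a common point its affine function would
  -- be both nonpositive and positive.
  separated : ∀ {j k} {p : Vector Point j} {q : Vector Point k} a b →
    (∀ i → ¬ 0# < orient a b (p i)) → (∀ i → 0# < orient a b (q i)) →
    ¬ (∃[ z ] ConvexHull p z × ConvexHull q z)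
  separated {p = p} {q} a b p≤0 q>0 (z , (v , 0≤v , Σv≈1 , z≈p) , (w , 0≤w , Σw≈1 , z≈q)) =
    weighted-sum-pos 0≤w q>0 (<-respʳ-≈ (sym Σw≈1) 0<1) λ 0<Σ →
      sum-nonneg (λ i → *-nonneg (0≤v i) (λ -p<0 → p≤0 i (neg-cancel -p<0)))
        (<-respˡ-≈ (sym eq) (0<y-x⇒x<y (<-respʳ-≈
          (solve 1 (λ x → x := con (+ 0) :- (:- x)) refl _) 0<Σ)))
    where
    open import Relation.Binary.Reasoning.Setoid (CommutativeRing.setoid commutativeRing)
    neg-cancel : ∀ {x} → - x < 0# → 0# < x
    neg-cancel {x} -x<0 = <-respʳ-≈ (solve 1 (λ x → :- (:- x) := x) refl x) (x<0⇒0<-x -x<0)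
    eq : sum (λ i → v i * - orient a b (p i)) ≈ - sum (λ i → w i * orient a b (q i))
    eq = begin
      sum (λ i → v i * - orient a b (p i))
        ≈⟨ sum-cong (λ i → solve 2 (λ v o → v :* (:- o) := (:- con (+ 1)) :* (v :* o) :+ con (+ 0) :* v) refl
             (v i) (orient a b (p i))) ⟩
      sum (λ i → (- 1#) * (v i * orient a b (p i)) + 0# * v i)
        ≈⟨ sum-linear (- 1#) 0# (λ i → v i * orient a b (p i)) v ⟩
      (- 1#) * sum (λ i → v i * orient a b (p i)) + 0# * sum v
        ≈⟨ solve 2 (λ s t → (:- con (+ 1)) :* s :+ con (+ 0) :* t := :- s) refl _ (sum v) ⟩
      - sum (λ i → v i * orient a b (p i))
        ≈⟨ -‿cong (orient-combination a b v p Σv≈1) ⟩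
      - orient a b (combination v p)
        ≈⟨ -‿cong (orient-cong (refl , refl) (refl , refl)
             (trans (sym (proj₁ z≈p)) (proj₁ z≈q) , trans (sym (proj₂ z≈p)) (proj₂ z≈q))) ⟩
      - orient a b (combination w q)
        ≈⟨ -‿cong (orient-combination a b w q Σw≈1) ⟨
      - sum (λ i → w i * orient a b (q i)) ∎

  segment⊆hull : ∀ {k} {p : Vector Point k} {α β} i j → 0# ≤ α → 0# ≤ β → α + β ≈ 1# → ∀ {x y} →
    x ≈ α * proj₁ (p i) + β * proj₁ (p j) → y ≈ α * proj₂ (p i) + β * proj₂ (p j) →
    ConvexHull p (x , y)
  segment⊆hull {k} {p} {α} {β} i j 0≤α 0≤β α+β≈1 x≈ y≈ =
    w , (λ l → +-nonneg (*-nonneg 0≤α (δ-nonneg i l)) (*-nonneg 0≤β (δ-nonneg j l))) ,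
    trans (sum-cong (λ l → sym (*-identityʳ (w l))))
      (trans (evaluate (λ _ → 1#)) (trans (+-cong (*-identityʳ α) (*-identityʳ β)) α+β≈1)) ,
    trans x≈ (sym (evaluate (proj₁ ∘ p))) ,
    trans y≈ (sym (evaluate (proj₂ ∘ p)))
    where
    w : Vector Carrier k
    w l = α * δ i l + β * δ j l
    evaluate : ∀ (f : Vector Carrier k) → sum (λ l → w l * f l) ≈ α * f i + β * f j
    evaluate f = trans
      (sum-cong (λ l → solve 5 (λ α β d e f → (α :* d :+ β :* e) :* f := α :* (d :* f) :+ β :* (e :* f))
        refl α β (δ i l) (δ j l) (f l)))
      (trans (sum-linear α β (λ l → δ i l * f l) (λ l → δ j l * f l)) (+-cong (*-congˡ (sum-δ i f)) (*-congˡ (sum-δ j f))))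

  shared-corner : ∀ {j k} {p : Vector Point j} {q : Vector Point k} i i′ → p i ≈ₚ q i′ →
    ∃[ z ] ConvexHull p z × ConvexHull q z
  shared-corner {p = p} i i′ (x≈ , y≈) = p i ,
    -- A corner is the segment from itself to itself, with weights 1 and 0.
    segment⊆hull i i 0≤1 (<-irrefl refl) (+-identityʳ 1#) (unit _) (unit _) ,
    segment⊆hull i′ i′ 0≤1 (<-irrefl refl) (+-identityʳ 1#) (trans x≈ (unit _)) (trans y≈ (unit _))
    where
    unit : ∀ x → x ≈ 1# * x + 0# * x
    unit = solve 1 (λ x → x := con (+ 1) :* x :+ con (+ 0) :* x) refl

  -- The barycentric coordinates of the intersection of the diagonals ac and bd
  -- are the ratios of triangle areas below.
  crossing-corners : ∀ {j k} {p : Vector Point j} {q : Vector Point k} i i′ l l′ →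
    0# < orient (p i) (q l) (p i′) → 0# < orient (p i) (q l) (q l′) →
    0# < orient (p i) (p i′) (q l′) → 0# < orient (q l) (p i′) (q l′) →
    ∃[ z ] ConvexHull p z × ConvexHull q z
  crossing-corners {p = p} {q} i i′ l l′ abc abd acd bcd
    with r , rs≈1 ← inverse (+-pos bcd abd) =
    _ ,
    segment⊆hull i i′ (<-asym (*-pos 0<r bcd)) (<-asym (*-pos 0<r abd))
      (trans (sym (distribˡ r _ _)) rs≈1) refl refl ,
    segment⊆hull l l′ (<-asym (*-pos 0<r acd)) (<-asym (*-pos 0<r abc))
      (trans (trans (sym (distribˡ r _ _)) (*-congˡ total)) rs≈1)
      -- The affine dependence of four points a, b, c, d of the plane: a weighted by `bcd` plus c
      -- weighted by `abd` equals b weighted by `acd` plus d weighted by `abc`.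
      (solve 9 (λ r ax ay bx by cx cy dx dy →
        r :* orientₛ bx by cx cy dx dy :* ax :+ r :* orientₛ ax ay bx by dx dy :* cx :=
        r :* orientₛ ax ay cx cy dx dy :* bx :+ r :* orientₛ ax ay bx by cx cy :* dx)
        refl r (proj₁ (p i)) (proj₂ (p i)) (proj₁ (q l)) (proj₂ (q l))
          (proj₁ (p i′)) (proj₂ (p i′)) (proj₁ (q l′)) (proj₂ (q l′)))
      (solve 9 (λ r ax ay bx by cx cy dx dy →
        r :* orientₛ bx by cx cy dx dy :* ay :+ r :* orientₛ ax ay bx by dx dy :* cy :=
        r :* orientₛ ax ay cx cy dx dy :* by :+ r :* orientₛ ax ay bx by cx cy :* dy)
        refl r (proj₁ (p i)) (proj₂ (p i)) (proj₁ (q l)) (proj₂ (q l))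
          (proj₁ (p i′)) (proj₂ (p i′)) (proj₁ (q l′)) (proj₂ (q l′)))
    where
    0<r : 0# < r
    0<r = *-cancelˡ-pos (+-pos bcd abd) (<-respʳ-≈ (trans (sym rs≈1) (*-comm r _)) 0<1)
    -- Both sides are twice the area of the quadrilateral, cut along one diagonal or the other.
    total : orient (p i) (p i′) (q l′) + orient (p i) (q l) (p i′) ≈
            orient (q l) (p i′) (q l′) + orient (p i) (q l) (q l′)
    total = solve 8 (λ ax ay bx by cx cy dx dy →
      orientₛ ax ay cx cy dx dy :+ orientₛ ax ay bx by cx cy :=
      orientₛ bx by cx cy dx dy :+ orientₛ ax ay bx by dx dy)
      refl (proj₁ (p i)) (proj₂ (p i)) (proj₁ (q l)) (proj₂ (q l))
        (proj₁ (p i′)) (proj₂ (p i′)) (proj₁ (q l′)) (proj₂ (q l′))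

-- The order of points on the circle

module CircleOrder {c ℓ₁ ℓ₂} (ℝ : RealNumbers c ℓ₁ ℓ₂) where
  open RealNumbers ℝ hiding (zero)
  open import Data.Integer.Base using (+_)
  open Plane ℝ
  open OrderedField ℝ
  open CircleGeometry ℝ

  -- The circle is cut at (-1, 0) and ordered by stereographic projection from
  -- that point, t = y / (1 + x); the point itself comes last.
  data Key : Set c where
    finite   : Carrier → Key
    infinite : Key

  data _≺_ : Rel Key (c ⊔ ℓ₂) where
    finite   : ∀ {s t} → s < t → finite s ≺ finite t
    infinite : ∀ {s} → finite s ≺ infinite

  data _~_ : Rel Key (c ⊔ ℓ₁) where
    finite   : ∀ {s t} → s ≈ t → finite s ~ finite t
    infinite : infinite ~ infinite

  ≺-irrefl : Irreflexive _~_ _≺_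
  ≺-irrefl (finite s≈t) (finite s<t) = <-irrefl s≈t s<t

  ≺-trans : Transitive _≺_
  ≺-trans (finite s<t) (finite t<u) = finite (<-trans s<t t<u)
  ≺-trans (finite s<t) infinite     = infinite

  ~-refl : ∀ {k} → k ~ k
  ~-refl {finite _} = finite refl
  ~-refl {infinite} = infinite

  ~-sym : Symmetric _~_
  ~-sym (finite s≈t) = finite (sym s≈t)
  ~-sym infinite     = infinite

  ≺-respʳ-~ : _≺_ Respectsʳ _~_
  ≺-respʳ-~ (finite t≈u) (finite s<t) = finite (<-respʳ-≈ t≈u s<t)
  ≺-respʳ-~ infinite     infinite     = infinite

  ≺-compare : ∀ k l → ¬ ¬ (k ≺ l ⊎ k ~ l ⊎ l ≺ k)
  ≺-compare (finite s) (finite t) ¬c = trichotomy s t λ where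
    (inj₁ s<t)        → ¬c (inj₁ (finite s<t))
    (inj₂ (inj₁ s≈t)) → ¬c (inj₂ (inj₁ (finite s≈t)))
    (inj₂ (inj₂ t<s)) → ¬c (inj₂ (inj₂ (finite t<s)))
  ≺-compare (finite _) infinite   ¬c = ¬c (inj₁ infinite)
  ≺-compare infinite   (finite _) ¬c = ¬c (inj₂ (inj₂ infinite))
  ≺-compare infinite   infinite   ¬c = ¬c (inj₂ (inj₁ infinite))

  -- The equation `(1# + x) * (1# + t * t) ≈ 2#` is the circle equation after substituting
  -- `y ≈ t * (1# + x)` and cancelling `1# + x`. A relation is used because a function would have to
  -- decide whether `1# + x` vanishes.
  data HasKey : Point → Key → Set (c ⊔ ℓ₁ ⊔ ℓ₂) where
    finite   : ∀ {x y t} → 0# < 1# + x → y ≈ t * (1# + x) → (1# + x) * (1# + t * t) ≈ 2# →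
               HasKey (x , y) (finite t)
    infinite : ∀ {x y} → 1# + x ≈ 0# → y ≈ 0# → HasKey (x , y) infinite

  open import Relation.Binary.Reasoning.Setoid (CommutativeRing.setoid commutativeRing)

  private
    y²≈ : ∀ {x y} → OnUnitCircle (x , y) → y * y ≈ (1# + x) * (1# - x)
    y²≈ {x} {y} on = begin
      y * y                            ≈⟨ solve 2 (λ x y → y :* y := (x :* x :+ y :* y) :- x :* x) refl x y ⟩
      (x * x + y * y) - x * x          ≈⟨ +-congʳ on ⟩
      1# - x * x                       ≈⟨ solve 1 (λ x → con (+ 1) :- x :* x := (con (+ 1) :+ x) :* (con (+ 1) :- x)) refl x ⟩
      (1# + x) * (1# - x)              ∎

  -- On the circle `y * y` equals `(1# + x) * (1# - x)`. A negative `1# + x` would make `1# - x`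
  -- positive and the square negative; a vanishing one forces `y` to vanish.
  has-key : ∀ {P} → OnUnitCircle P → ¬ ¬ (∃[ k ] HasKey P k)
  has-key {x , y} on ¬key = trichotomy (1# + x) 0# λ where
    (inj₁ u<0) → square-≮0 y (<-respˡ-≈ (sym (trans (y²≈ on) (*-comm _ _)))
      (*-pos-neg (<-respʳ-≈ (solve 1 (λ x → (:- (con (+ 1) :+ x)) :+ con (+ 2) := con (+ 1) :- x) refl x)
        (+-pos (x<0⇒0<-x u<0) 0<2)) u<0))
    (inj₂ (inj₁ u≈0)) → ¬key (_ , infinite u≈0
      (square≈0 (trans (y²≈ on) (trans (*-congʳ u≈0) (zeroˡ _)))))
    (inj₂ (inj₂ 0<u)) → let v , vu≈1 = inverse 0<u in
      ¬key (_ , finite 0<u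
        (begin
          y                    ≈⟨ *-identityʳ y ⟨
          y * 1#               ≈⟨ *-congˡ vu≈1 ⟨
          y * (v * (1# + x))   ≈⟨ *-assoc y v (1# + x) ⟨
          y * v * (1# + x)     ∎)
        (begin
          (1# + x) * (1# + y * v * (y * v))
            ≈⟨ solve 3 (λ x y v → (con (+ 1) :+ x) :* (con (+ 1) :+ y :* v :* (y :* v)) :=
                 (con (+ 1) :+ x) :+ y :* y :* v :* (v :* (con (+ 1) :+ x))) refl x y v ⟩
          (1# + x) + y * y * v * (v * (1# + x))
            ≈⟨ +-congˡ (*-cong (*-congʳ (y²≈ on)) vu≈1) ⟩
          (1# + x) + (1# + x) * (1# - x) * v * 1#
            ≈⟨ solve 2 (λ x v → (con (+ 1) :+ x) :+ (con (+ 1) :+ x) :* (con (+ 1) :- x) :* v :* con (+ 1) :=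
                 (con (+ 1) :+ x) :+ (con (+ 1) :- x) :* (v :* (con (+ 1) :+ x))) refl x v ⟩
          (1# + x) + (1# - x) * (v * (1# + x))
            ≈⟨ +-congˡ (*-congˡ vu≈1) ⟩
          (1# + x) + (1# - x) * 1#
            ≈⟨ solve 1 (λ x → (con (+ 1) :+ x) :+ (con (+ 1) :- x) :* con (+ 1) := con (+ 2)) refl x ⟩
          2# ∎))

  -- A finite key `t` determines `1# + x` as 2 divided by `1# + t * t`, and then `y`.
  key-injective : ∀ {P Q k l} → HasKey P k → HasKey Q l → k ~ l → P ≈ₚ Q
  key-injective (infinite u≈0 y≈0) (infinite u′≈0 y′≈0) infinite =
    x≈ (trans u≈0 (sym u′≈0)) , trans y≈0 (sym y′≈0)
    where
    x≈ : ∀ {x x′} → 1# + x ≈ 1# + x′ → x ≈ x′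
    x≈ {x} {x′} eq = begin
      x                  ≈⟨ solve 1 (λ x → x := (con (+ 1) :+ x) :- con (+ 1)) refl x ⟩
      1# + x - 1#        ≈⟨ +-congʳ eq ⟩
      1# + x′ - 1#       ≈⟨ solve 1 (λ x → x := (con (+ 1) :+ x) :- con (+ 1)) refl x′ ⟨
      x′                 ∎
  key-injective {x , y} {x′ , y′} (finite {t = t} 0<u y≈ u≈) (finite {t = t′} 0<u′ y′≈ u′≈) (finite t≈t′) =
    x≈ , (begin
      y                  ≈⟨ y≈ ⟩
      t * (1# + x)       ≈⟨ *-cong t≈t′ (+-congˡ x≈) ⟩
      t′ * (1# + x′)     ≈⟨ y′≈ ⟨
      y′                 ∎)
    where
    2x≈ : 2# * x ≈ 2# * x′
    2x≈ = begin
      2# * x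
        ≈⟨ solve 1 (λ x → con (+ 2) :* x := (con (+ 1) :+ x) :* con (+ 2) :- con (+ 2)) refl x ⟩
      (1# + x) * 2# - 2#
        ≈⟨ +-congʳ (*-congˡ u′≈) ⟨
      (1# + x) * ((1# + x′) * (1# + t′ * t′)) - 2#
        ≈⟨ +-congʳ (*-congˡ (*-congˡ (+-congˡ (*-cong t≈t′ t≈t′)))) ⟨
      (1# + x) * ((1# + x′) * (1# + t * t)) - 2#
        ≈⟨ solve 3 (λ u u′ w → u :* (u′ :* w) :- con (+ 2) := u′ :* (u :* w) :- con (+ 2)) refl
             (1# + x) (1# + x′) (1# + t * t) ⟩
      (1# + x′) * ((1# + x) * (1# + t * t)) - 2#
        ≈⟨ +-congʳ (*-congˡ u≈) ⟩
      (1# + x′) * 2# - 2#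
        ≈⟨ solve 1 (λ x → con (+ 2) :* x := (con (+ 1) :+ x) :* con (+ 2) :- con (+ 2)) refl x′ ⟨
      2# * x′ ∎
    x≈ : x ≈ x′
    x≈ = *-cancelˡ 0<2 2x≈

  -- Up to positive factors `1# + x` the orientation is half the Vandermonde product
  -- `(b - a) * (d - b) * (d - a)` of the keys, or just `b - a` when the last key is infinite.
  orient-pos : ∀ {A B C k l m} → HasKey A k → HasKey B l → HasKey C m → k ≺ l → l ≺ m →
    0# < orient A B C
  orient-pos {xa , ya} {xb , yb} {xc , yc}
    (finite {t = a} 0<u ya≈ _) (finite {t = b} 0<v yb≈ _) (infinite xc≈ yc≈) (finite a<b) infinite =
    <-respʳ-≈ (sym (begin
      orient (xa , ya) (xb , yb) (xc , yc)
        ≈⟨ orient-cong (refl , ya≈) (refl , yb≈)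
             (trans (solve 1 (λ x → x := (con (+ 1) :+ x) :- con (+ 1)) refl xc) (+-congʳ xc≈) , yc≈) ⟩
      orient (xa , a * (1# + xa)) (xb , b * (1# + xb)) (0# - 1# , 0#)
        ≈⟨ solve 4 (λ xa xb a b →
             (xb :- xa) :* (con (+ 0) :- a :* (con (+ 1) :+ xa)) :-
             (b :* (con (+ 1) :+ xb) :- a :* (con (+ 1) :+ xa)) :* ((con (+ 0) :- con (+ 1)) :- xa) :=
             (con (+ 1) :+ xa) :* (con (+ 1) :+ xb) :* (b :- a)) refl xa xb a b ⟩
      (1# + xa) * (1# + xb) * (b - a) ∎))
    (*-pos (*-pos 0<u 0<v) (x<y⇒0<y-x a<b))
  orient-pos {xa , ya} {xb , yb} {xc , yc}
    (finite {t = a} 0<u ya≈ u≈) (finite {t = b} 0<v yb≈ v≈) (finite {t = d} 0<w yc≈ w≈) (finite a<b) (finite b<d) =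
    *-cancelˡ-pos 0<2 (<-respʳ-≈ (sym (begin
      2# * orient (xa , ya) (xb , yb) (xc , yc)
        ≈⟨ *-congˡ (orient-cong (refl , ya≈) (refl , yb≈) (refl , yc≈)) ⟩
      2# * orient (xa , a * u) (xb , b * v) (xc , d * w)
        ≈⟨ solve 6 (λ xa xb xc a b d →
             let u = con (+ 1) :+ xa ; v = con (+ 1) :+ xb ; w = con (+ 1) :+ xc in
             con (+ 2) :* ((xb :- xa) :* (d :* w :- a :* u) :- (b :* v :- a :* u) :* (xc :- xa)) :=
             con (+ 2) :* (v :* w :* (d :- b)) :- con (+ 2) :* (u :* w :* (d :- a)) :+
             con (+ 2) :* (u :* v :* (b :- a))) refl xa xb xc a b d ⟩
      2# * (v * w * (d - b)) - 2# * (u * w * (d - a)) + 2# * (u * v * (b - a))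
        -- In each term the factor 2 is replaced by `(1# + x) * (1# + t * t)` of the point missing
        -- from it, so that every term contains `u * v * w`.
        ≈⟨ +-cong (+-cong (*-congʳ u≈) (-‿cong (*-congʳ v≈))) (*-congʳ w≈) ⟨
      u * (1# + a * a) * (v * w * (d - b)) - v * (1# + b * b) * (u * w * (d - a)) + w * (1# + d * d) * (u * v * (b - a))
        ≈⟨ solve 6 (λ u v w a b d →
             u :* (con (+ 1) :+ a :* a) :* (v :* w :* (d :- b)) :- v :* (con (+ 1) :+ b :* b) :* (u :* w :* (d :- a)) :+
             w :* (con (+ 1) :+ d :* d) :* (u :* v :* (b :- a)) :=
             u :* v :* w :* ((b :- a) :* (d :- b) :* (d :- a))) refl u v w a b d ⟩
      u * v * w * ((b - a) * (d - b) * (d - a)) ∎))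
    (*-pos (*-pos (*-pos 0<u 0<v) 0<w)
      (*-pos (*-pos (x<y⇒0<y-x a<b) (x<y⇒0<y-x b<d)) (x<y⇒0<y-x (<-trans a<b b<d)))))
    where
    u = 1# + xa
    v = 1# + xb
    w = 1# + xc

open import Data.List.Base
  using (List; []; _∷_; [_]; _++_; map; length; filter; lookup; take; drop; foldr; concat; allFin; tabulate)
open import Data.List.Extrema.Nat using (min; max; argmin-all; argmax-all; min≤xs; xs≤max)
import Data.List.Membership.DecPropositional as DecMembership
open import Data.List.Membership.Propositional using (_∈_; _∉_; find; lose)
open import Data.List.Membership.Propositional.Properties
  using (∈-++⁺ˡ; ∈-++⁺ʳ; ∈-++⁻; ∈-allFin; ∈-concat⁺′; ∈-filter⁺; ∈-filter⁻; ∈-map⁺; ∈-map⁻; ∈-tabulate⁺; ∈-tabulate⁻)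
open import Data.List.Properties using (filter-++; length-++; length-map; length-tabulate)
open import Data.List.Relation.Binary.Permutation.Propositional using (↭-sym; ↭⇒↭ₛ)
open import Data.List.Relation.Binary.Permutation.Propositional.Properties using (∈-resp-↭)
import Data.List.Relation.Binary.Permutation.Setoid.Properties as Permutation
open import Data.List.Relation.Unary.All as All using (All; []; _∷_)
import Data.List.Relation.Unary.All.Properties as All
open import Data.List.Relation.Unary.AllPairs as AllPairs using (AllPairs; []; _∷_)
import Data.List.Relation.Unary.AllPairs.Properties as AllPairs
open import Data.List.Relation.Unary.Any as Any using (Any; here; there)
import Data.List.Relation.Unary.Any.Properties as Any
import Data.List.Relation.Unary.Linked.Properties as Linked
open import Data.List.Relation.Unary.Unique.Propositional.Properties using (allFin⁺)
import Data.List.Sort as Sort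
open import Data.Nat.Base hiding (zero; suc; _⊔_)
open import Data.Nat.ListAction using (sum)
open import Data.Nat.Properties
open import Data.Nat.Tactic.RingSolver using (solve-∀)
import Relation.Binary.Construct.Flip.EqAndOrd as Flip
import Relation.Binary.Construct.On as On
open import Relation.Binary.PropositionalEquality.Core
open import Relation.Binary.PropositionalEquality.Properties using (setoid; module ≡-Reasoning)

private
  variable
    a b p q r s : Level
    A : Set a
    B : Set b

-- Colouring circular arrangements

module _ {P : Pred A p} {Q : Pred A q} (P? : Decidable P) (Q? : Decidable Q) where

  filter-mono-≤ : ∀ xs → (∀ {x} → x ∈ xs → P x → Q x) →
    length (filter P? xs) ≤ length (filter Q? xs)
  filter-mono-≤ [] P⇒Q = z≤n
  filter-mono-≤ (x ∷ xs) P⇒Q with P? x | Q? x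
  ... | yes _  | yes _  = s≤s (filter-mono-≤ xs (P⇒Q ∘ there))
  ... | yes px | no ¬qx = contradiction (P⇒Q (here refl) px) ¬qx
  ... | no _   | yes _  = m≤n⇒m≤1+n (filter-mono-≤ xs (P⇒Q ∘ there))
  ... | no _   | no _   = filter-mono-≤ xs (P⇒Q ∘ there)

  filter-mono-< : ∀ {xs} → (∀ {x} → x ∈ xs → P x → Q x) →
    ∀ {y} → y ∈ xs → ¬ P y → Q y → length (filter P? xs) < length (filter Q? xs)
  filter-mono-< {x ∷ xs} P⇒Q y∈xs ¬py qy with P? x | Q? x | y∈xs
  ... | yes px | _      | here refl = contradiction px ¬py
  ... | no _   | yes _  | here refl = s≤s (filter-mono-≤ xs (P⇒Q ∘ there))
  ... | no _   | no ¬qy | here refl = contradiction qy ¬qy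
  ... | yes _  | yes _  | there y∈  = s≤s (filter-mono-< (P⇒Q ∘ there) y∈ ¬py qy)
  ... | yes px | no ¬qx | there _   = contradiction (P⇒Q (here refl) px) ¬qx
  ... | no _   | yes _  | there y∈  = m<n⇒m<1+n (filter-mono-< (P⇒Q ∘ there) y∈ ¬py qy)
  ... | no _   | no _   | there y∈  = filter-mono-< (P⇒Q ∘ there) y∈ ¬py qy

open DecMembership _≟_ using (_∈?_)

some-missing : (cs : List ℕ) → ¬ (∀ (i : Fin (suc (length cs))) → toℕ i ∈ cs)
some-missing cs all with i , j , i<j , eq ← Fin.pigeonhole ≤-refl (Any.index ∘ all) =
  <⇒≢ i<j (begin
    toℕ i                          ≡⟨ Any.lookup-index (all i) ⟩
    lookup cs (Any.index (all i))  ≡⟨ cong (lookup cs) eq ⟩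
    lookup cs (Any.index (all j))  ≡⟨ Any.lookup-index (all j) ⟨
    toℕ j                          ∎)
  where open ≡-Reasoning

-- By the pigeonhole principle one of the numbers up to `length cs` is missing.
least-missing : (cs : List ℕ) →
  ∃[ c ] c ≤ length cs × c ∉ cs × (∀ {i} → i < c → i ∈ cs)
least-missing cs
  with i , i∉ , below ← Fin.¬∀⟶∃¬-smallest (suc (length cs)) (λ i → toℕ i ∈ cs)
    (λ i → toℕ i ∈? cs) (some-missing cs)
  = toℕ i , Fin.toℕ≤pred[n] i , i∉ ,
    λ j<i → subst (_∈ cs) (trans (Fin.toℕ-inject _) (Fin.toℕ-fromℕ< j<i)) (below (fromℕ< j<i))

AllPairs-compare : ∀ {R : Rel A r} {xs x y} → AllPairs R xs → x ∈ xs → y ∈ xs →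
  x ≢ y → R x y ⊎ R y x
AllPairs-compare _          (here refl) (here refl) x≢y = contradiction refl x≢y
AllPairs-compare (px ∷ _)   (here refl) (there y∈)  _   = inj₁ (All.lookup px y∈)
AllPairs-compare (px ∷ _)   (there x∈)  (here refl) _   = inj₂ (All.lookup px x∈)
AllPairs-compare (_ ∷ pxs)  (there x∈)  (there y∈)  x≢y = AllPairs-compare pxs x∈ y∈ x≢y

-- The elements of the list are coloured from its end to its front, each with
-- the least colour that is still free.
module FirstFit {A : Set a} (_≟ᴬ_ : DecidableEquality A)
  {S : Rel A s} (S⇒≢ : ∀ {v u} → S v u → v ≢ u) {C : Rel A r} (C? : Decidable₂ C) where

  -- Every smaller colour is blocked by a neighbour `u` with `S v u`. As `S` holds from each vertex
  -- of the list to all later ones, it records what is known about vertices coloured before `v`.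
  IsFirstFit : List A → (A → ℕ) → Set _
  IsFirstFit vs f =
    AllPairs (λ v u → C v u → f v ≢ f u) vs ×
    All (λ v → ∀ {i} → i < f v → ∃[ u ] u ∈ vs × S v u × C v u × f u ≡ i) vs

  firstFit : ∀ {vs} → AllPairs S vs → ∃[ f ] IsFirstFit vs f
  firstFit [] = (λ _ → 0) , [] , []
  firstFit {v ∷ vs} (Sv ∷ Svs)
    with f , proper , first ← firstFit Svs
    with c , _ , c∉ , c-least ← least-missing (map f (filter (C? v) vs))
    = g , All.tabulate proper-v ∷ properᵍ ,
      (λ i<gv → first-v (subst (_ <_) g-v i<gv)) ∷ firstᵍ
    where
    g : A → ℕ
    g u with u ≟ᴬ v
    ... | yes _ = c
    ... | no _  = f u

    g-v : g v ≡ c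
    g-v with v ≟ᴬ v
    ... | yes _  = refl
    ... | no v≢v = contradiction refl v≢v

    g-vs : ∀ {u} → u ∈ vs → g u ≡ f u
    g-vs {u} u∈ with u ≟ᴬ v
    ... | yes refl = contradiction refl (S⇒≢ (All.lookup Sv u∈))
    ... | no _     = refl

    proper-v : ∀ {u} → u ∈ vs → C v u → g v ≢ g u
    proper-v u∈ Cvu eq = c∉ (subst (_∈ _) (trans (sym (g-vs u∈)) (trans (sym eq) g-v))
      (∈-map⁺ f (∈-filter⁺ (C? v) u∈ Cvu)))

    properᵍ : AllPairs (λ v u → C v u → g v ≢ g u) vs
    properᵍ = transport vs (g-vs) proper
      where
      transport : ∀ us → (∀ {u} → u ∈ us → g u ≡ f u) →
        AllPairs (λ v u → C v u → f v ≢ f u) us → AllPairs (λ v u → C v u → g v ≢ g u) us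
      transport []       _  _          = []
      transport (u ∷ us) eq (pu ∷ pus) =
        All.tabulate (λ w∈ Cuw gu≡gw → All.lookup pu w∈ Cuw
          (trans (sym (eq (here refl))) (trans gu≡gw (eq (there w∈))))) ∷
        transport us (eq ∘ there) pus

    first-v : ∀ {i} → i < c → ∃[ u ] u ∈ v ∷ vs × S v u × C v u × g u ≡ i
    first-v i<c with u , u∈f , eq ← ∈-map⁻ f (c-least i<c)
                with u∈ , Cvu ← ∈-filter⁻ (C? v) {xs = vs} u∈f =
      u , there u∈ , All.lookup Sv u∈ , Cvu , trans (g-vs u∈) (sym eq)

    firstᵍ : All (λ w → ∀ {i} → i < g w → ∃[ u ] u ∈ v ∷ vs × S w u × C w u × g u ≡ i) vs
    firstᵍ = All.tabulate λ {w} w∈ i<gw →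
      case All.lookup first w∈ (subst (_ <_) (g-vs w∈) i<gw) of λ where
        (u , u∈ , Swu , Cwu , eq) → u , there u∈ , Swu , Cwu , trans (g-vs u∈) eq

-- Double counting along the antidiagonals of a matrix

sumTo : (ℕ → ℕ) → ℕ → ℕ
sumTo f zero    = 0
sumTo f (suc n) = f 0 + sumTo (f ∘ suc) n

sumTo-cong : ∀ {f g} → (∀ i → f i ≡ g i) → ∀ n → sumTo f n ≡ sumTo g n
sumTo-cong eq zero    = refl
sumTo-cong eq (suc n) = cong₂ _+_ (eq 0) (sumTo-cong (eq ∘ suc) n)

sumTo-+ : ∀ f g n → sumTo (λ i → f i + g i) n ≡ sumTo f n + sumTo g n
sumTo-+ f g zero    = refl
sumTo-+ f g (suc n) = trans (cong (f 0 + g 0 +_) (sumTo-+ (f ∘ suc) (g ∘ suc) n)) (interchange (f 0) _ _ _)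
  where
  interchange : ∀ w x y z → w + x + (y + z) ≡ w + y + (x + z)
  interchange = solve-∀

sumTo-≤ : ∀ {f w} → (∀ i → f i ≤ w) → ∀ n → sumTo f n ≤ n * w
sumTo-≤ f≤ zero    = z≤n
sumTo-≤ f≤ (suc n) = +-mono-≤ (f≤ 0) (sumTo-≤ (f≤ ∘ suc) n)

AllPairs-take-drop : ∀ {R : Rel A r} {x y} d {xs} → AllPairs R xs →
  x ∈ take d xs → y ∈ drop d xs → R x y
AllPairs-take-drop (suc d) (px ∷ _)  (here refl) y∈ = All.lookup px (drop-⊆ d y∈)
  where
  drop-⊆ : ∀ d {xs : List A} {y} → y ∈ drop d xs → y ∈ xs
  drop-⊆ zero    y∈ = y∈
  drop-⊆ (suc d) {_ ∷ _} y∈ = there (drop-⊆ d y∈)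
AllPairs-take-drop (suc d) (_ ∷ pxs) (there x∈)  y∈ = AllPairs-take-drop d pxs x∈ y∈

take-⊆-take : ∀ d {xs : List A} {x} → x ∈ take d xs → x ∈ take (suc d) xs
take-⊆-take (suc d) {_ ∷ _} (here refl) = here refl
take-⊆-take (suc d) {_ ∷ _} (there x∈)  = there (take-⊆-take d x∈)

-- A matrix with all chains (going down and to the left) of length at most w
-- has at most w ones on each antidiagonal.
module Grid {A : Set a} {B : Set b} {R : REL A B r} (R? : Decidable₂ R)
  {P : Rel A p} {Q : Rel B q} where

  private
    _▷_ : Rel (A × B) _
    (x , y) ▷ (x′ , y′) = P x x′ × Q y′ y

  -- A matrix entry as a list of length at most one, so that an antidiagonal, on which row and
  -- column index add up to `d`, is a concatenation of entries.
  cell : A → List B → ℕ → List (A × B)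
  cell x []       _       = []
  cell x (y ∷ ys) zero    with R? x y
  ... | yes _ = [ x , y ]
  ... | no _  = []
  cell x (y ∷ ys) (suc d) = cell x ys d

  antidiagonal : List A → List B → ℕ → List (A × B)
  antidiagonal []       ys d       = []
  antidiagonal (x ∷ xs) ys zero    = cell x ys 0
  antidiagonal (x ∷ xs) ys (suc d) = cell x ys (suc d) ++ antidiagonal xs ys d

  cell⁻ : ∀ {x} ys d {xy} → xy ∈ cell x ys d →
    proj₁ xy ≡ x × proj₂ xy ∈ take (suc d) ys × proj₂ xy ∈ drop d ys × R x (proj₂ xy)
  cell⁻ {x} (y ∷ ys) zero xy∈ with R? x y | xy∈
  ... | yes Rxy | here refl = refl , here refl , here refl , Rxy
  cell⁻ (y ∷ ys) (suc d) xy∈ with eq , ∈take , ∈drop , Rxy ← cell⁻ ys d xy∈ =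
    eq , there ∈take , ∈drop , Rxy

  antidiagonal⁻ : ∀ xs ys d {xy} → xy ∈ antidiagonal xs ys d →
    proj₁ xy ∈ xs × proj₂ xy ∈ take (suc d) ys × R (proj₁ xy) (proj₂ xy)
  antidiagonal⁻ (x ∷ xs) ys zero    xy∈ with refl , ∈take , _ , Rxy ← cell⁻ ys 0 xy∈ =
    here refl , ∈take , Rxy
  antidiagonal⁻ (x ∷ xs) ys (suc d) xy∈ with ∈-++⁻ (cell x ys (suc d)) xy∈
  ... | inj₁ xy∈ with refl , ∈take , _ , Rxy ← cell⁻ ys (suc d) xy∈ = here refl , ∈take , Rxy
  ... | inj₂ xy∈ with x∈ , ∈take , Rxy ← antidiagonal⁻ xs ys d xy∈ =
    there x∈ , take-⊆-take (suc d) ∈take , Rxy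

  cell-chain : ∀ x ys d → AllPairs _▷_ (cell x ys d)
  cell-chain x []       d       = []
  cell-chain x (y ∷ ys) zero    with R? x y
  ... | yes _ = [] ∷ []
  ... | no _  = []
  cell-chain x (y ∷ ys) (suc d) = cell-chain x ys d

  -- The entry in the top row lies beyond the first `suc d` columns, while all entries further down
  -- lie among them.
  antidiagonal-chain : ∀ {xs ys} → AllPairs P xs → AllPairs Q ys → ∀ d →
    AllPairs _▷_ (antidiagonal xs ys d)
  antidiagonal-chain []         Qys d       = []
  antidiagonal-chain {x ∷ _} {ys} (_ ∷ _) Qys zero = cell-chain x ys 0
  antidiagonal-chain {x ∷ xs} {ys} (Px ∷ Pxs) Qys (suc d) =
    AllPairs.++⁺ (cell-chain x ys (suc d)) (antidiagonal-chain Pxs Qys d)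
      (All.tabulate λ xy∈ → All.tabulate λ xy′∈ →
        case cell⁻ ys (suc d) xy∈ , antidiagonal⁻ xs ys d xy′∈ of λ where
          ((refl , _ , ∈drop , _) , (x′∈ , ∈take , _)) →
            All.lookup Px x′∈ , AllPairs-take-drop (suc d) Qys ∈take ∈drop)

  length-cells : ∀ x ys {m} → length ys ≤ m →
    sumTo (length ∘ cell x ys) m ≡ length (filter (R? x) ys)
  length-cells x []       {zero}  _         = refl
  length-cells x []       {suc m} _         = length-cells x [] {m} z≤n
  length-cells x (y ∷ ys) {suc m} (s≤s ys≤) with R? x y
  ... | yes _ = cong suc (length-cells x ys ys≤)
  ... | no _  = length-cells x ys ys≤

  count : List A → List B → ℕ
  count xs ys = sum (map (λ x → length (filter (R? x) ys)) xs)

  -- Row and column index of an entry add up to less than `length xs + length ys`, so every one of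
  -- the matrix is counted on exactly one antidiagonal.
  length-antidiagonals : ∀ xs ys →
    sumTo (length ∘ antidiagonal xs ys) (length xs + length ys) ≡ count xs ys
  length-antidiagonals []       ys = none (length ys)
    where
    none : ∀ n → sumTo (λ _ → 0) n ≡ 0
    none zero    = refl
    none (suc n) = none n
  length-antidiagonals (x ∷ xs) ys = begin
    length (cell x ys 0) + sumTo (λ d → length (cell x ys (suc d) ++ antidiagonal xs ys d)) m
      ≡⟨ cong (length (cell x ys 0) +_) (sumTo-cong (λ d → length-++ (cell x ys (suc d))) m) ⟩
    length (cell x ys 0) + sumTo (λ d → length (cell x ys (suc d)) + length (antidiagonal xs ys d)) m
      ≡⟨ cong (length (cell x ys 0) +_) (sumTo-+ (length ∘ cell x ys ∘ suc) (length ∘ antidiagonal xs ys) m) ⟩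
    length (cell x ys 0) + (sumTo (length ∘ cell x ys ∘ suc) m + sumTo (length ∘ antidiagonal xs ys) m)
      ≡⟨ +-assoc (length (cell x ys 0)) _ _ ⟨
    sumTo (length ∘ cell x ys) (suc m) + sumTo (length ∘ antidiagonal xs ys) m
      ≡⟨ cong₂ _+_ (length-cells x ys (m≤n⇒m≤1+n (m≤n+m (length ys) (length xs)))) (length-antidiagonals xs ys) ⟩
    length (filter (R? x) ys) + count xs ys ∎
    where
    open ≡-Reasoning
    m = length xs + length ys

  count-≤ : ∀ {xs ys w} → AllPairs P xs → AllPairs Q ys →
    (∀ {zs} → All (λ (x , y) → x ∈ xs × y ∈ ys × R x y) zs → AllPairs _▷_ zs → length zs ≤ w) →
    count xs ys ≤ (length xs + length ys) * w
  count-≤ {xs} {ys} Pxs Qys chain≤ = subst (_≤ _) (length-antidiagonals xs ys)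
    (sumTo-≤ (λ d → chain≤
      (All.tabulate λ xy∈ → case antidiagonal⁻ xs ys d xy∈ of λ where
        (x∈ , y∈ , Rxy) → x∈ , take-⊆ (suc d) y∈ , Rxy)
      (antidiagonal-chain Pxs Qys d)) (length xs + length ys))
    where
    take-⊆ : ∀ d {ys : List B} {y} → y ∈ take d ys → y ∈ ys
    take-⊆ (suc d) {_ ∷ _} (here refl) = here refl
    take-⊆ (suc d) {_ ∷ _} (there y∈)  = there (take-⊆ d y∈)

-- Corners are positions on the line that is obtained by cutting the circle open.
record Arrangement {n : ℕ} (Adj : Rel (Fin n) a) (ω : ℕ) : Set a where
  field
    adj-sym : Symmetric Adj
    adj⇒≢   : ∀ {u v} → Adj u v → u ≢ v
    corners : Fin n → List ℕ
    lo hi   : Fin n → ℕ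
    lo∈     : ∀ v → lo v ∈ corners v
    hi∈     : ∀ v → hi v ∈ corners v
    lo≤     : ∀ {v x} → x ∈ corners v → lo v ≤ x
    ≤hi     : ∀ {v x} → x ∈ corners v → x ≤ hi v
    lo<hi   : ∀ v → lo v < hi v
    share   : ∀ {u v x} → u ≢ v → x ∈ corners u → x ∈ corners v → Adj u v
    cross   : ∀ {u v w x y z} → u ≢ v → w < x → x < y → y < z →
              w ∈ corners u → x ∈ corners v → y ∈ corners u → z ∈ corners v → Adj u v
    -- The geometric content of adjacency: if no corner of `v` were in the hull interval of `u`, a
    -- chord of `u` would separate the two polygons.
    meets   : ∀ {u v} → Adj u v → ∃[ x ] x ∈ corners v × lo u ≤ x × x ≤ hi u
    clique≤ : ∀ {vs} → AllPairs Adj vs → length vs ≤ ω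

module _ {n : ℕ} where

  module _ (O : DecTotalOrder 0ℓ 0ℓ 0ℓ) (key : Fin n → DecTotalOrder.Carrier O) where

    private
      open module O = DecTotalOrder O using () renaming (_≤_ to _≤ᴷ_)

      Oᵏ = On.decTotalOrder O key
      vs : List (Fin n)
      vs = Sort.sort Oᵏ (allFin n)

      S : Rel (Fin n) _
      S v u = v ≢ u × key v ≤ᴷ key u

      ∈vs : ∀ v → v ∈ vs
      ∈vs v = ∈-resp-↭ (↭-sym (Sort.sort-↭ Oᵏ (allFin n))) (∈-allFin v)

      S-vs : AllPairs S vs
      S-vs = AllPairs.zip
        ( Permutation.Unique-resp-↭ (setoid (Fin n))
            (↭⇒↭ₛ (↭-sym (Sort.sort-↭ Oᵏ (allFin n)))) (allFin⁺ n)
        , Linked.Linked⇒AllPairs O.trans (Sort.sort-↗ Oᵏ (allFin n)))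

    -- The list is sorted by increasing key and coloured from its end, so a vertex is blocked only
    -- by vertices whose key is at least its own. Flipping `O` reverses the direction.
    sorted-first-fit : ∀ {C : Rel (Fin n) r} → Decidable₂ C → Symmetric C →
      ∃[ f ] (∀ {u v} → u ≢ v → C u v → f u ≢ f v) ×
             (∀ v {i} → i < f v → ∃[ u ] v ≢ u × key v ≤ᴷ key u × C v u × f u ≡ i)
    sorted-first-fit {C = C} C? C-sym =
      let f , proper , first = firstFit S-vs in
      f ,
      (λ {u} {v} u≢v Cuv → case AllPairs-compare proper (∈vs u) (∈vs v) u≢v of λ where
        (inj₁ f≢) → f≢ Cuv
        (inj₂ f≢) → ≢-sym (f≢ (C-sym Cuv))) ,
      (λ v i<fv → let u , _ , (v≢u , v≤u) , Cvu , eq = All.lookup first (∈vs v) i<fv in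
        u , v≢u , v≤u , Cvu , eq)
      where open FirstFit Fin._≟_ {S = S} proj₁ C?

-- Colouring polygons with a common pillar

module PivotColouring {n ω a} {Adj : Rel (Fin n) a} (M : Arrangement Adj ω) where
  open Arrangement M

  private V = Fin n

  ColouringOf : Rel V 0ℓ → Set
  ColouringOf _▹_ = Σ[ f ∈ (V → Fin ω) ] (∀ {u v} → u ≢ v → u ▹ v → f u ≢ f v)

  module _ (O : DecTotalOrder 0ℓ 0ℓ 0ℓ) (key : V → DecTotalOrder.Carrier O)
    {_▹_ : Rel V 0ℓ} (_▹?_ : Decidable₂ _▹_)
    (▹⇒adj : ∀ {u v} → u ≢ v → u ▹ v → Adj u v)
    -- Puts every blocking vertex on the left of `_▹_`, whichever way the conflict was found.
    (▹-later : ∀ {u v} → DecTotalOrder._≤_ O (key v) (key u) → v ▹ u → u ▹ v) where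

    private
      ff = sorted-first-fit O key (λ u v → (u ▹? v) ⊎-dec (v ▹? u)) swap

      f : V → ℕ
      f = proj₁ ff

      f-proper : ∀ {u v} → u ≢ v → u ▹ v → f u ≢ f v
      f-proper u≢v u▹v = proj₁ (proj₂ ff) u≢v (inj₁ u▹v)

      earlier : ∀ v {i} → i < f v → ∃[ u ] v ≢ u × u ▹ v × f u ≡ i
      earlier v i<fv = case proj₂ (proj₂ ff) v i<fv of λ where
        (u , v≢u , v≤u , inj₁ v▹u , eq) → u , v≢u , ▹-later v≤u v▹u , eq
        (u , v≢u , v≤u , inj₂ u▹v , eq) → u , v≢u , u▹v , eq

    bounded-colouring : (∀ v → f v < ω) → ColouringOf _▹_
    bounded-colouring f<ω = (λ v → fromℕ< (f<ω v)) ,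
      λ {u} {v} u≢v u▹v eq → f-proper u≢v u▹v (Fin.fromℕ<-injective (f u) (f v) (f<ω u) (f<ω v) eq)

    -- The blocking vertices of `v`, one for each colour below `f v`, are pairwise related; with `v`
    -- they form a clique of `suc (f v)` vertices.
    fork-colouring : (∀ {u u′ v} → u ▹ v → u′ ▹ v → u ▹ u′ ⊎ u′ ▹ u) → ColouringOf _▹_
    fork-colouring ▹-fork = bounded-colouring λ v →
      let g : Fin (f v) → V
          g i = proj₁ (earlier v (Fin.toℕ<n i))
          v≢g = λ i → proj₁ (proj₂ (earlier v (Fin.toℕ<n i)))
          g▹v = λ i → proj₁ (proj₂ (proj₂ (earlier v (Fin.toℕ<n i))))
          fg  = λ i → proj₂ (proj₂ (proj₂ (earlier v (Fin.toℕ<n i))))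
          g-injective : ∀ {i j} → g i ≡ g j → i ≡ j
          g-injective {i} {j} eq = Fin.toℕ-injective (trans (sym (fg i)) (trans (cong f eq) (fg j)))
          g-adj : ∀ {i j} → i ≢ j → Adj (g i) (g j)
          g-adj {i} {j} i≢j = case ▹-fork (g▹v i) (g▹v j) of λ where
            (inj₁ gi▹gj) → ▹⇒adj (i≢j ∘ g-injective) gi▹gj
            (inj₂ gj▹gi) → adj-sym (▹⇒adj (i≢j ∘ sym ∘ g-injective) gj▹gi)
      in subst (_≤ ω) (cong suc (length-tabulate g)) (clique≤
           (All.tabulate⁺ (λ i → adj-sym (▹⇒adj (v≢g i ∘ sym) (g▹v i))) ∷ AllPairs.tabulate⁺ g-adj))

    -- From `v` one descends through the colours, each time to a vertex that blocks the next lower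
    -- colour. By transitivity the vertices met form a clique with `v`.
    transitive-colouring : (∀ {u v} → u ▹ v → u ≢ v) → Transitive _▹_ → ColouringOf _▹_
    transitive-colouring ▹⇒≢ ▹-trans = bounded-colouring λ v →
      case chain (f v) v refl of λ where
        (us , us▹ , length-us , us▹v) → subst (_≤ ω) (cong suc length-us) (clique≤
          (AllPairs.map (λ u▹v → adj-sym (▹⇒adj (▹⇒≢ u▹v) u▹v)) (us▹v ∷ us▹)))
      where
      chain : ∀ k v → f v ≡ k → ∃[ us ] AllPairs (flip _▹_) us × length us ≡ k × All (_▹ v) us
      chain zero    v eq = [] , [] , refl , []
      chain (suc k) v eq
        with u , _ , u▹v , fu ← earlier v {k} (subst (k <_) (sym eq) ≤-refl)
        with us , us▹ , refl , us▹u ← chain k u fu =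
        u ∷ us , us▹u ∷ us▹ , refl , u▹v ∷ All.map (λ w▹u → ▹-trans w▹u u▹v) us▹u

  module Pivot (p : ℕ) where

    Contains : V → Set
    Contains v = lo v < p × p ≤ hi v

    contains? : ∀ v → Dec (Contains v)
    contains? v = (lo v <? p) ×-dec (p ≤? hi v)

    -- In `Left` and `Right`, `u` reaches at least as far out as `v` and has a corner between the
    -- extreme corner of `v` and the pillar. Each of the three relations forces adjacency of
    -- distinct polygons, and together they cover all adjacent pairs ordered by `lo`.
    Left Right Up : Rel V 0ℓ
    Left  u v = Contains u × Contains v × lo u ≤ lo v × Any (λ x → lo v ≤ x × x < p) (corners u)
    Right u v = Contains u × Contains v × hi v ≤ hi u × Any (λ x → p ≤ x × x ≤ hi v) (corners u)
    Up    u v = Contains u × Contains v × lo u < lo v × hi u < hi v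

    left⇒adj : ∀ {u v} → u ≢ v → Left u v → Adj u v
    left⇒adj {u} {v} u≢v (_ , (_ , p≤v) , u≤v , any)
      with x , x∈ , v≤x , x<p ← find any
      with m≤n⇒m<n∨m≡n u≤v | m≤n⇒m<n∨m≡n v≤x
    ... | inj₂ u≡v | _        = share u≢v (lo∈ u) (subst (_∈ corners v) (sym u≡v) (lo∈ v))
    ... | inj₁ u<v | inj₂ refl = share u≢v x∈ (lo∈ v)
    ... | inj₁ u<v | inj₁ v<x =
      cross u≢v u<v v<x (<-≤-trans x<p p≤v) (lo∈ u) (lo∈ v) x∈ (hi∈ v)

    right⇒adj : ∀ {u v} → u ≢ v → Right u v → Adj u v
    right⇒adj {u} {v} u≢v (_ , (v<p , _) , v≤u , any)
      with x , x∈ , p≤x , x≤v ← find any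
      with m≤n⇒m<n∨m≡n v≤u | m≤n⇒m<n∨m≡n x≤v
    ... | inj₂ v≡u | _        = share u≢v (hi∈ u) (subst (_∈ corners v) v≡u (hi∈ v))
    ... | inj₁ v<u | inj₂ refl = share u≢v x∈ (hi∈ v)
    ... | inj₁ v<u | inj₁ x<v =
      adj-sym (cross (≢-sym u≢v) (<-≤-trans v<p p≤x) x<v v<u (lo∈ v) x∈ (hi∈ v) (hi∈ u))

    up⇒adj : ∀ {u v} → u ≢ v → Up u v → Adj u v
    up⇒adj {u} {v} u≢v ((_ , p≤u) , (v<p , _) , lo< , hi<) =
      cross u≢v lo< (<-≤-trans v<p p≤u) hi< (lo∈ u) (lo∈ v) (hi∈ u) (hi∈ v)

    abstract
      left : ColouringOf Left
      left = fork-colouring (Flip.decTotalOrder ≤-decTotalOrder) lo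
        (λ u v → contains? u ×-dec contains? v ×-dec (lo u ≤? lo v) ×-dec
                 Any.any? (λ x → (lo v ≤? x) ×-dec (x <? p)) (corners u))
        left⇒adj
        -- Here `lo u` and `lo v` coincide, so the first corner of `u` is the witness.
        (λ {u} {v} u≤v (cv , cu , v≤u , _) →
          cu , cv , u≤v , lose (lo∈ u) (v≤u , proj₁ cu))
        (λ {u} {u′} (cu , _ , u≤v , x) (cu′ , _ , u′≤v , x′) → case ≤-total (lo u) (lo u′) of λ where
          (inj₁ u≤u′) → inj₁ (cu , cu′ , u≤u′ , Any.map (λ (v≤x , x<p) → ≤-trans u′≤v v≤x , x<p) x)
          (inj₂ u′≤u) → inj₂ (cu′ , cu , u′≤u , Any.map (λ (v≤x , x<p) → ≤-trans u≤v v≤x , x<p) x′))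

      right : ColouringOf Right
      right = fork-colouring ≤-decTotalOrder hi
        (λ u v → contains? u ×-dec contains? v ×-dec (hi v ≤? hi u) ×-dec
                 Any.any? (λ x → (p ≤? x) ×-dec (x ≤? hi v)) (corners u))
        right⇒adj
        (λ {u} {v} v≤u (cv , cu , u≤v , _) →
          cu , cv , v≤u , lose (hi∈ u) (proj₂ cu , u≤v))
        (λ {u} {u′} (cu , _ , v≤u , x) (cu′ , _ , v≤u′ , x′) → case ≤-total (hi u′) (hi u) of λ where
          (inj₁ u′≤u) → inj₁ (cu , cu′ , u′≤u , Any.map (λ (p≤x , x≤v) → p≤x , ≤-trans x≤v v≤u′) x)
          (inj₂ u≤u′) → inj₂ (cu′ , cu , u≤u′ , Any.map (λ (p≤x , x≤v) → p≤x , ≤-trans x≤v v≤u) x′))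

      up : ColouringOf Up
      up = transitive-colouring (Flip.decTotalOrder ≤-decTotalOrder) lo
        (λ u v → contains? u ×-dec contains? v ×-dec (lo u <? lo v) ×-dec (hi u <? hi v))
        up⇒adj
        (λ u≤v (_ , _ , v<u , _) → contradiction v<u (≤⇒≯ u≤v))
        (λ { (_ , _ , u<u , _) refl → <-irrefl refl u<u })
        (λ (cu , _ , lo< , hi<) (_ , cw , lo<′ , hi<′) → cu , cw , <-trans lo< lo<′ , <-trans hi< hi<′)

    colour : V → Fin (ω * (ω * ω))
    colour v = combine (proj₁ left v) (combine (proj₁ right v) (proj₁ up v))

    private
      adj⇒related : ∀ {u v} → Contains u → Contains v → lo u ≤ lo v → Adj u v →
        Left u v ⊎ Right u v ⊎ Up u v
      adj⇒related {u} {v} cu cv u≤v adj with <-cmp (hi u) (hi v)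
      ... | tri≈ _ eq _ = inj₂ (inj₁ (cu , cv , ≤-reflexive (sym eq) ,
                            lose (hi∈ u) (proj₂ cu , ≤-reflexive eq)))
      ... | tri< hi< _ _ with m≤n⇒m<n∨m≡n u≤v
      ...   | inj₁ lo< = inj₂ (inj₂ (cu , cv , lo< , hi<))
      ...   | inj₂ eq  = inj₁ (cu , cv , u≤v , lose (lo∈ u) (≤-reflexive (sym eq) , proj₁ cu))
      -- The hull interval of `v` is nested in that of `u`; a corner of `u` inside it lies on one
      -- side of the pillar.
      adj⇒related {u} {v} cu cv u≤v adj | tri> _ _ v<u
        with x , x∈ , v≤x , x≤v ← meets (adj-sym adj) with x <? p
      ... | yes x<p = inj₁ (cu , cv , u≤v , lose x∈ (v≤x , x<p))
      ... | no x≮p  = inj₂ (inj₁ (cu , cv , <⇒≤ v<u , lose x∈ (≮⇒≥ x≮p , x≤v)))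

      colour-proper-≤ : ∀ {u v} → Contains u → Contains v → lo u ≤ lo v → Adj u v → colour u ≢ colour v
      colour-proper-≤ {u} {v} cu cv u≤v adj eq
        with eqˡ , eq′ ← Fin.combine-injective (proj₁ left u) _ (proj₁ left v) _ eq
        with eqʳ , eqᵘ ← Fin.combine-injective (proj₁ right u) _ (proj₁ right v) _ eq′
        with adj⇒related cu cv u≤v adj
      ... | inj₁ l        = proj₂ left (adj⇒≢ adj) l eqˡ
      ... | inj₂ (inj₁ r) = proj₂ right (adj⇒≢ adj) r eqʳ
      ... | inj₂ (inj₂ u) = proj₂ up (adj⇒≢ adj) u eqᵘ

    colour-proper : ∀ {u v} → Contains u → Contains v → Adj u v → colour u ≢ colour v
    colour-proper {u} {v} cu cv adj with ≤-total (lo u) (lo v)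
    ... | inj₁ u≤v = colour-proper-≤ cu cv u≤v adj
    ... | inj₂ v≤u = ≢-sym (colour-proper-≤ cv cu v≤u (adj-sym adj))

-- Cutting segments and assigning classes to pillars

splitAt-or-short : ∀ m (xs : List A) → length xs ≤ m ⊎
  ∃[ ys ] ∃[ z ] ∃[ zs ] xs ≡ ys ++ z ∷ zs × length ys ≡ m × length xs ≡ suc (m + length zs)
splitAt-or-short m       []       = inj₁ z≤n
splitAt-or-short zero    (x ∷ xs) = inj₂ ([] , x , xs , refl , refl , refl)
splitAt-or-short (suc m) (x ∷ xs) with splitAt-or-short m xs
... | inj₁ xs≤ = inj₁ (s≤s xs≤)
... | inj₂ (ys , z , zs , refl , eq , eq′) =
  inj₂ (x ∷ ys , z , zs , refl , cong suc eq , cong suc eq′)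

length*≤sum : ∀ {f : A → ℕ} {w xs} → All (λ x → w ≤ f x) xs → length xs * w ≤ sum (map f xs)
length*≤sum []         = z≤n
length*≤sum (w≤ ∷ ws≤) = +-mono-≤ w≤ (length*≤sum ws≤)

1+3n≤2^2n : ∀ n → 1 + 3 * n ≤ 2 ^ (2 * n)
1+3n≤2^2n zero    = ≤-refl
1+3n≤2^2n (suc n) = begin
  1 + 3 * suc n      ≡⟨ left n ⟩
  1 + 3 * n + 3      ≤⟨ +-mono-≤ (1+3n≤2^2n n) (*-monoʳ-≤ 3 (m^n>0 2 (2 * n))) ⟩
  m + 3 * m          ≡⟨ right m ⟩
  2 ^ (2 + 2 * n)    ≡⟨ cong (2 ^_) (*-suc 2 n) ⟨
  2 ^ (2 * suc n)    ∎
  where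
  open ≤-Reasoning
  m = 2 ^ (2 * n)
  left : ∀ n → 1 + 3 * suc n ≡ 1 + 3 * n + 3
  left = solve-∀
  right : ∀ m → m + 3 * m ≡ 2 * (2 * m)
  right = solve-∀

-- If `k` were at least `3 * ω`, then `k * suc (2 * ω)`, the excess of the left side over `k * ω`,
-- would be more than `5 * ω * ω`.
few-rows : ∀ ω .{{_ : NonZero ω}} {k} → k * suc (3 * ω) ≤ (k + 5 * ω) * ω → suc k < 2 ^ (2 * ω)
few-rows ω {k} k≤ = <-≤-trans (s≤s (≰⇒> λ 3ω≤k → <⇒≱ (step 3ω≤k) k≤)) (1+3n≤2^2n ω)
  where
  open ≤-Reasoning
  split : ∀ k ω → k * suc (3 * ω) ≡ k * ω + k * suc (2 * ω)
  split = solve-∀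
  surplus : ∀ k ω → k * ω + 3 * ω * suc (2 * ω) ≡ ω + ((k + 5 * ω) * ω + (ω * ω + 2 * ω))
  surplus = solve-∀
  step : 3 * ω ≤ k → (k + 5 * ω) * ω < k * suc (3 * ω)
  step 3ω≤k = begin-strict
    (k + 5 * ω) * ω                               ≤⟨ m≤m+n _ _ ⟩
    (k + 5 * ω) * ω + (ω * ω + 2 * ω)             <⟨ m<n+m _ (>-nonZero⁻¹ ω) ⟩
    ω + ((k + 5 * ω) * ω + (ω * ω + 2 * ω))       ≡⟨ surplus k ω ⟨
    k * ω + 3 * ω * suc (2 * ω)                   ≤⟨ +-monoʳ-≤ (k * ω) (*-monoˡ-≤ (suc (2 * ω)) 3ω≤k) ⟩
    k * ω + k * suc (2 * ω)                       ≡⟨ split k ω ⟨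
    k * suc (3 * ω)                               ∎

module PillarColouring {n ω a} {Adj : Rel (Fin n) a} (M : Arrangement Adj ω)
  .{{_ : NonZero ω}} (c₀ : Fin (7 * ω)) where
  open Arrangement M
  open PivotColouring M

  private
    V      = Fin n
    Class  = Fin (7 * ω)
    Colour = Class × Fin (ω * (ω * ω))

  Inside : ℕ → ℕ → V → Set
  Inside s e v = s ≤ lo v × hi v < e

  -- The vertices of the segment [start, end) that are assigned to a pillar
  -- just before position pivot.
  record Group : Set where
    constructor group
    field
      start pivot end : ℕ
      class           : Class

  open Group

  Member : Group → V → Set
  Member g v = Inside (start g) (end g) v × Pivot.Contains (pivot g) v

  Touches : ℕ → ℕ → Group → Set
  Touches s e g = ∃[ v ] Member g v × Any (λ x → s ≤ x × x < e) (corners v)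

  touches? : ∀ s e → Decidable (Touches s e)
  touches? s e g = Fin.any? λ v →
    (((start g ≤? lo v) ×-dec (hi v <? end g)) ×-dec Pivot.contains? (pivot g) v) ×-dec
    Any.any? (λ x → (s ≤? x) ×-dec (x <? e)) (corners v)

  seen : List Group → ℕ → ℕ → ℕ
  seen gs s e = length (filter (touches? s e) gs)

  seen-∷ : ∀ g gs s e → seen (g ∷ gs) s e ≤ suc (seen gs s e)
  seen-∷ g gs s e with touches? s e g
  ... | yes _ = ≤-refl
  ... | no _  = n≤1+n _

  seen-∷ʳ : ∀ g gs s e → seen (gs ++ [ g ]) s e ≤ suc (seen gs s e)
  seen-∷ʳ g gs s e = begin
    seen (gs ++ [ g ]) s e                                        ≡⟨ cong length (filter-++ (touches? s e) gs [ g ]) ⟩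
    length (filter (touches? s e) gs ++ filter (touches? s e) [ g ]) ≡⟨ length-++ (filter (touches? s e) gs) ⟩
    seen gs s e + seen [ g ] s e                                  ≤⟨ +-monoʳ-≤ (seen gs s e) (seen-∷ g [] s e) ⟩
    seen gs s e + 1                                               ≡⟨ +-comm (seen gs s e) 1 ⟩
    suc (seen gs s e)                                             ∎
    where open ≤-Reasoning

  Escapes : ℕ → ℕ → Group → Set
  Escapes s e g = ∀ v → Member g v → ∃[ y ] y ∈ corners v × (y < s ⊎ e ≤ y)

  -- In a `Context` the corner `y` of `v`, the corner `x` of `u`, an outer end of `v` and an outer
  -- end of `u` follow each other in this order around the circle, hence alternate; if `x` equals
  -- `y`, the corner is shared.
  Crossing : ℕ → ℕ → Group → Group → Set _
  Crossing s e g h = ∀ u v {x y} → Member g u → Member h v → x ∈ corners u → y ∈ corners v →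
    s ≤ y → y ≤ x → x < e → Adj u v

  -- The groups that a segment can see, listed by the position of their ends
  -- outside the segment, from its left boundary leftwards and around the
  -- circle back to its right boundary.
  Context : ℕ → ℕ → List Group → Set _
  Context s e gs = All (Escapes s e) gs × AllPairs (Crossing s e) gs

  escapes⇒≢ : ∀ {s e u v y} → Inside s e v → y ∈ corners u → y < s ⊎ e ≤ y → u ≢ v
  escapes⇒≢ (s≤v , _) y∈ (inj₁ y<s) refl = <⇒≱ y<s (≤-trans s≤v (lo≤ y∈))
  escapes⇒≢ (_ , v<e) y∈ (inj₂ e≤y) refl = <⇒≱ v<e (≤-trans e≤y (≤hi y∈))

  -- The corner `x` of `u` lies between two corners of `v`, and `y` lies outside the segment that
  -- contains all of `v`: the four alternate unless `x` is shared.
  straddle : ∀ {s e u v w x y z} → Inside s e v → y ∈ corners u → y < s ⊎ e ≤ y →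
    w ∈ corners v → x ∈ corners u → z ∈ corners v → w ≤ x → x ≤ z → Adj u v
  straddle {s} {e} {u} {v} in-v@(s≤v , v<e) y∈ y-out w∈ x∈ z∈ w≤x x≤z
    with escapes⇒≢ in-v y∈ y-out | m≤n⇒m<n∨m≡n w≤x | m≤n⇒m<n∨m≡n x≤z | y-out
  ... | u≢v | inj₂ refl | _         | _        = share u≢v x∈ w∈
  ... | u≢v | inj₁ _    | inj₂ refl | _        = share u≢v x∈ z∈
  ... | u≢v | inj₁ w<x  | inj₁ x<z  | inj₁ y<s =
    cross u≢v (<-≤-trans y<s (≤-trans s≤v (lo≤ w∈))) w<x x<z y∈ w∈ x∈ z∈
  ... | u≢v | inj₁ w<x  | inj₁ x<z  | inj₂ e≤y =
    adj-sym (cross (≢-sym u≢v) w<x x<z (≤-<-trans (≤hi z∈) (<-≤-trans v<e e≤y)) w∈ x∈ z∈ y∈)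

  Context-mono : ∀ {s s′ e e′ gs} → s ≤ s′ → e′ ≤ e → Context s e gs → Context s′ e′ gs
  Context-mono {s} {s′} {e} {e′} s≤s′ e′≤e (escapes , ordered) =
    All.map (λ {g} → escapes-mono {g}) escapes ,
    AllPairs.map (λ {g} {h} → crossing-mono {g} {h}) ordered
    where
    crossing-mono : ∀ {g h} → Crossing s e g h → Crossing s′ e′ g h
    crossing-mono cr u v mu mv x∈ y∈ s′≤y y≤x x<e′ =
      cr u v mu mv x∈ y∈ (≤-trans s≤s′ s′≤y) y≤x (<-≤-trans x<e′ e′≤e)

    escapes-mono : ∀ {g} → Escapes s e g → Escapes s′ e′ g
    escapes-mono esc v m with esc v m
    ... | y , y∈ , inj₁ y<s = y , y∈ , inj₁ (<-≤-trans y<s s≤s′)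
    ... | y , y∈ , inj₂ e≤y = y , y∈ , inj₂ (≤-trans e′≤e e≤y)

  -- Members of the new group leave `[s, p)` across its right boundary but stay inside `[s, e)`,
  -- which the older groups leave. So the new group comes last in the circular listing.
  Context-left : ∀ {s p e c gs} → p ≤ e → Context s e gs → Context s p (gs ++ [ group s p e c ])
  Context-left {s} {p} {e} {c} {gs} p≤e ctx@(escapes , _)
    with escapes′ , ordered′ ← Context-mono ≤-refl p≤e ctx =
    All.++⁺ escapes′ ((λ v (_ , _ , p≤v) → hi v , hi∈ v , inj₂ p≤v) ∷ []) ,
    AllPairs.++⁺ ordered′ ([] ∷ []) (All.map (λ {g} esc → crossing {g} esc ∷ []) escapes)
    where
    crossing : ∀ {g} → Escapes s e g → Crossing s p g (group s p e c)
    crossing esc u v mu (in-v , _ , p≤v) x∈ y∈ _ y≤x x<p with w , w∈ , out ← esc u mu =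
      straddle in-v w∈ out y∈ x∈ (hi∈ v) y≤x (<⇒≤ (<-≤-trans x<p p≤v))

  -- The mirror image: the new group ends just across the left boundary of `[p, e)` and comes first.
  Context-right : ∀ {s p e c gs} → s ≤ p → Context s e gs → Context p e (group s p e c ∷ gs)
  Context-right {s} {p} {e} {c} {gs} s≤p ctx@(escapes , _)
    with escapes′ , ordered′ ← Context-mono s≤p ≤-refl ctx =
    (λ v (_ , v<p , _) → lo v , lo∈ v , inj₁ v<p) ∷ escapes′ ,
    All.map (λ {g} esc → crossing {g} esc) escapes ∷ ordered′
    where
    crossing : ∀ {g} → Escapes s e g → Crossing p e (group s p e c) g
    crossing esc v u (in-v , v<p , _) mu x∈ y∈ p≤y y≤x _ with w , w∈ , out ← esc u mu =
      adj-sym (straddle in-v w∈ out (lo∈ v) y∈ x∈ (<⇒≤ (<-≤-trans v<p p≤y)) y≤x)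

  Context-filter : ∀ {s e gs} {P : Pred Group 0ℓ} (P? : Decidable P) →
    Context s e gs → Context s e (filter P? gs)
  Context-filter P? (escapes , ordered) = All.filter⁺ P? escapes , AllPairs.filter⁺ P? ordered

  -- The field `avoids` protects against the groups that reach in from outside; it is what allows
  -- two segments to be joined at a pillar.
  record SegmentColouring (s e : ℕ) (gs : List Group) : Set a where
    field
      colour : V → Colour
      proper : ∀ {u v} → Inside s e u → Inside s e v → Adj u v → colour u ≢ colour v
      avoids : ∀ {u v g} → g ∈ gs → Inside s e u → Member g v → Adj u v →
               proj₁ (colour u) ≢ class g

  open SegmentColouring

  -- A hull interval contains two different positions, so none fits inside and the colours are
  -- placeholders.
  short : ∀ {s e gs} → e ≤ suc s → SegmentColouring s e gs
  short {s} {e} e≤ = record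
    { colour = λ u → c₀ , Pivot.colour 0 u
    ; proper = λ in-u → contradiction in-u outside
    ; avoids = λ _ in-u → contradiction in-u outside
    }
    where
    outside : ∀ {u} → ¬ Inside s e u
    outside {u} (s≤u , u<e) = <⇒≱ (lo<hi u) (≤-trans (s≤s⁻¹ (≤-trans u<e e≤)) s≤u)

  inside-adj⇒touches : ∀ {s e u v g} → Inside s e u → Member g v → Adj u v → Touches s e g
  inside-adj⇒touches (s≤u , u<e) m adj with x , x∈ , u≤x , x≤u ← meets adj =
    _ , m , lose x∈ (≤-trans s≤u u≤x , ≤-<-trans x≤u u<e)

  -- By `meets`, a group without a corner in the segment has no member adjacent to a vertex inside.
  extend : ∀ {s e gs} → SegmentColouring s e (filter (touches? s e) gs) → SegmentColouring s e gs
  extend {s} {e} c = record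
    { colour = colour c
    ; proper = proper c
    ; avoids = λ {_} {_} {g} g∈ in-u m adj →
        avoids c (∈-filter⁺ (touches? s e) g∈ (inside-adj⇒touches {g = g} in-u m adj)) in-u m adj
    }

  data Side (p : ℕ) (v : V) : Set where
    left  : hi v < p → Side p v
    mid   : Pivot.Contains p v → Side p v
    right : p ≤ lo v → Side p v

  side : ∀ p v → Side p v
  side p v with hi v <? p | lo v <? p
  ... | yes hi<p | _        = left hi<p
  ... | no hi≮p  | yes lo<p = mid (lo<p , ≮⇒≥ hi≮p)
  ... | no _     | no lo≮p  = right (≮⇒≥ lo≮p)

  -- Vertices on opposite sides of the pillar are never adjacent. A vertex containing it differs in
  -- class from its neighbours on either side because both parts avoid the new group, and from the
  -- old groups because `c` is fresh.
  node : ∀ {s p e gs} c → All (λ g → c ≢ class g) gs →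
    SegmentColouring s p (gs ++ [ group s p e c ]) →
    SegmentColouring p e (group s p e c ∷ gs) →
    SegmentColouring s e gs
  node {s} {p} {e} {gs} c fresh cˡ cʳ = record
    { colour = λ v → f v (side p v)
    ; proper = λ {u} {v} → f-proper (side p u) (side p v)
    ; avoids = λ {u} → f-avoids (side p u)
    }
    where
    f : ∀ v → Side p v → Colour
    f v (left _)  = colour cˡ v
    f v (mid _)   = c , Pivot.colour p v
    f v (right _) = colour cʳ v

    new∈ : group s p e c ∈ gs ++ [ group s p e c ]
    new∈ = ∈-++⁺ʳ gs (here refl)

    apart : ∀ {u v} → hi u < p → p ≤ lo v → ¬ Adj u v
    apart u<p p≤v adj with x , x∈ , _ , x≤u ← meets adj =
      <⇒≱ u<p (≤-trans p≤v (≤-trans (lo≤ x∈) x≤u))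

    f-proper : ∀ {u v} (su : Side p u) (sv : Side p v) →
      Inside s e u → Inside s e v → Adj u v → f u su ≢ f v sv
    f-proper (left u<p)  (left v<p)  (s≤u , _) (s≤v , _) adj = proper cˡ (s≤u , u<p) (s≤v , v<p) adj
    f-proper (left u<p)  (mid v∋p)   (s≤u , _) in-v adj eq =
      avoids cˡ new∈ (s≤u , u<p) (in-v , v∋p) adj (cong proj₁ eq)
    f-proper (left u<p)  (right p≤v) _ _ adj = contradiction adj (apart u<p p≤v)
    f-proper (mid u∋p)   (left v<p)  in-u (s≤v , _) adj eq =
      avoids cˡ new∈ (s≤v , v<p) (in-u , u∋p) (adj-sym adj) (cong proj₁ (sym eq))
    f-proper (mid u∋p)   (mid v∋p)   _ _ adj eq = Pivot.colour-proper p u∋p v∋p adj (cong proj₂ eq)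
    f-proper (mid u∋p)   (right p≤v) in-u (_ , v<e) adj eq =
      avoids cʳ (here refl) (p≤v , v<e) (in-u , u∋p) (adj-sym adj) (cong proj₁ (sym eq))
    f-proper (right p≤u) (left v<p)  _ _ adj = contradiction (adj-sym adj) (apart v<p p≤u)
    f-proper (right p≤u) (mid v∋p)   (_ , u<e) in-v adj eq =
      avoids cʳ (here refl) (p≤u , u<e) (in-v , v∋p) adj (cong proj₁ eq)
    f-proper (right p≤u) (right p≤v) (_ , u<e) (_ , v<e) adj = proper cʳ (p≤u , u<e) (p≤v , v<e) adj

    f-avoids : ∀ {u v g} (su : Side p u) → g ∈ gs → Inside s e u → Member g v → Adj u v →
      proj₁ (f u su) ≢ class g
    f-avoids (left u<p)  g∈ (s≤u , _) = avoids cˡ (∈-++⁺ˡ g∈) (s≤u , u<p)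
    f-avoids (mid _)     g∈ _ _ _     = All.lookup fresh g∈
    f-avoids (right p≤u) g∈ (_ , u<e) = avoids cʳ (there g∈) (p≤u , u<e)

  fresh-class : ∀ gs → length gs < 7 * ω → ∃[ c ] All (λ g → c ≢ class g) gs
  fresh-class gs gs< with c , c≤ , c∉ , _ ← least-missing (map (toℕ ∘ class) gs) =
    fromℕ< c<N , All.tabulate λ g∈ eq → c∉ (subst (_∈ _)
      (trans (cong toℕ (sym eq)) (Fin.toℕ-fromℕ< c<N)) (∈-map⁺ (toℕ ∘ class) g∈))
    where
    c<N : c < 7 * ω
    c<N = ≤-<-trans c≤ (subst (_< 7 * ω) (sym (length-map (toℕ ∘ class) gs)) gs<)

  -- A single position may see any number of groups, because no vertex fits inside it.
  Light : List Group → ℕ → ℕ → Set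
  Light gs s e = seen gs s e ≤ 3 * ω ⊎ e ≤ suc s

  data Cuts (gs : List Group) : ℕ → ℕ → List ℕ → Set where
    done : ∀ {s e} → Light gs s e → Cuts gs s e []
    cut  : ∀ {s p e ps} → s < p → p < e → Light gs s p → Cuts gs p e ps → Cuts gs s e (p ∷ ps)

  Cuts-++⁻ : ∀ {gs s e} ps {p qs} → Cuts gs s e (ps ++ p ∷ qs) →
    s < p × p < e × Cuts gs s p ps × Cuts gs p e qs
  Cuts-++⁻ []       (cut s<p p<e light cuts) = s<p , p<e , done light , cuts
  Cuts-++⁻ (x ∷ ps) (cut s<x x<e light cuts) with x<p , p<e , cutsˡ , cutsʳ ← Cuts-++⁻ ps cuts =
    <-trans s<x x<p , p<e , cut s<x x<p light cutsˡ , cutsʳ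

  -- A cut at y after a piece starting at x is made only if the closed interval
  -- [x, y] is heavy; consecutive such intervals share at most an endpoint.
  Heavy : List Group → ℕ × ℕ → Set
  Heavy gs (x , y) = 3 * ω < seen gs x (suc y)

  Within : ℕ → ℕ → ℕ × ℕ → Set
  Within s e (x , y) = s ≤ x × y < e

  _≼_ : Rel (ℕ × ℕ) 0ℓ
  (_ , y) ≼ (x′ , _) = y ≤ x′

  record Sweep (gs : List Group) (s e : ℕ) : Set where
    field
      {pivots} : List ℕ
      cuts     : Cuts gs s e pivots
      rows     : List (ℕ × ℕ)
      length≡  : length rows ≡ length pivots
      within   : All (Within s e) rows
      sorted   : AllPairs _≼_ rows
      heavy    : All (Heavy gs) rows

  -- A greedy scan with current piece `[s, m)` and `k` positions left. The piece grows until one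
  -- more position would make it see more than `3 * ω` groups, and is then cut at `m`.
  sweep : ∀ gs {e} k s m → m + k ≡ e → s < m → Light gs s m → Sweep gs s e
  sweep gs zero s m eq s<m light = record
    { cuts = done (subst (Light gs s) (trans (sym (+-identityʳ m)) eq) light)
    ; rows = [] ; length≡ = refl ; within = [] ; sorted = [] ; heavy = [] }
  sweep gs {e} (suc k) s m eq s<m light with seen gs s (suc m) ≤? 3 * ω
  ... | yes few = sweep gs k s (suc m) (trans (sym (+-suc m k)) eq) (m<n⇒m<1+n s<m) (inj₁ few)
  ... | no many = record
    { cuts    = cut s<m m<e light (cuts next)
    ; rows    = (s , m) ∷ rows next
    ; length≡ = cong suc (length≡ next)
    ; within  = (≤-refl , m<e) ∷ All.map (λ (m≤x , y<e) → ≤-trans (<⇒≤ s<m) m≤x , y<e) (within next)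
    ; sorted  = All.map proj₁ (within next) ∷ sorted next
    ; heavy   = ≰⇒> many ∷ heavy next
    }
    where
    open Sweep
    m<e : m < e
    m<e = subst (m <_) eq (m<m+n m z<s)
    next : Sweep gs m e
    -- The next piece starts as the single position `m`, which is light whatever it sees.
    next = sweep gs k m (suc m) (trans (sym (+-suc m k)) eq) ≤-refl (inj₂ ≤-refl)

  -- A chain going down and to the left has corners in weakly increasing position and groups in
  -- decreasing order, so by `Crossing` its vertices form a clique. Rows may share an endpoint
  -- because `Crossing` admits equal corners.
  seen-rows : ∀ {gs s e rows} → Context s e gs → All (Within s e) rows → AllPairs _≼_ rows →
    sum (map (λ (x , y) → seen gs x (suc y)) rows) ≤ (length rows + length gs) * ω
  seen-rows {gs} {s} {e} {rows} (_ , ordered) within sorted = Grid.count-≤ row? sorted ordered chain≤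
    where
    Row : ℕ × ℕ → Group → Set
    Row (x , y) = Touches x (suc y)

    row? : ∀ r g → Dec (Row r g)
    row? (x , y) = touches? x (suc y)

    Entry : (ℕ × ℕ) × Group → Set
    Entry (r , g) = r ∈ rows × g ∈ gs × Row r g

    vertex : ∀ {z} → Entry z → V
    vertex (_ , _ , v , _) = v

    adj : ∀ {r r′ g g′} (t : Entry (r , g)) (t′ : Entry (r′ , g′)) → r ≼ r′ → Crossing s e g′ g →
      Adj (vertex t) (vertex t′)
    adj (r∈ , _ , v , m , any) (r′∈ , _ , v′ , m′ , any′) y≤x′ crossing =
      let x , x∈ , l≤x , x<u = find any
          x′ , x′∈ , l′≤x′ , x′<u′ = find any′
          s≤l , _ = All.lookup within r∈
          _ , u′<e = All.lookup within r′∈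
      in adj-sym (crossing v′ v m′ m x′∈ x∈ (≤-trans s≤l l≤x)
           (≤-trans (s≤s⁻¹ x<u) (≤-trans y≤x′ l′≤x′)) (<-≤-trans x′<u′ u′<e))

    length-reduce : ∀ {zs} (ts : All Entry zs) → length (All.reduce vertex ts) ≡ length zs
    length-reduce []       = refl
    length-reduce (_ ∷ ts) = cong suc (length-reduce ts)

    clique : ∀ {zs} (ts : All Entry zs) →
      AllPairs (λ (r , g) (r′ , g′) → r ≼ r′ × Crossing s e g′ g) zs →
      AllPairs Adj (All.reduce vertex ts)
    clique []       []         = []
    clique {(r₀ , g₀) ∷ _} (t ∷ ts) (pz ∷ pzs) = adjacent ts pz ∷ clique ts pzs
      where
      adjacent : ∀ {zs} (ts : All Entry zs) → All (λ (r , g) → r₀ ≼ r × Crossing s e g g₀) zs →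
        All (Adj (vertex t)) (All.reduce vertex ts)
      adjacent []         []                     = []
      adjacent (t′ ∷ ts′) ((r≼r′ , crossing) ∷ cs) = adj t t′ r≼r′ crossing ∷ adjacent ts′ cs

    chain≤ : ∀ {zs} → All Entry zs → AllPairs (λ (r , g) (r′ , g′) → r ≼ r′ × Crossing s e g′ g) zs →
      length zs ≤ ω
    chain≤ ts pzs = subst (_≤ ω) (length-reduce ts) (clique≤ (clique ts pzs))

  -- The `suc` leaves room for the cut that `colour-segment` puts in front of the sweep.
  few-cuts : ∀ {gs s e} → Context s e gs → length gs ≤ 5 * ω → (sw : Sweep gs s e) →
    suc (length (Sweep.pivots sw)) < 2 ^ (2 * ω)
  few-cuts {gs} ctx gs≤ sw = subst (λ k → suc k < _) length≡ (few-rows ω (begin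
    length rows * suc (3 * ω)                       ≤⟨ length*≤sum heavy ⟩
    sum (map (λ (x , y) → seen gs x (suc y)) rows)  ≤⟨ seen-rows ctx within sorted ⟩
    (length rows + length gs) * ω                   ≤⟨ *-monoˡ-≤ ω (+-monoʳ-≤ (length rows) gs≤) ⟩
    (length rows + 5 * ω) * ω                       ∎))
    where
    open ≤-Reasoning
    open Sweep sw

  -- The pivots are inserted in a balanced fashion, so that a piece sees at
  -- most one new group for each of the 2ω levels.
  module Balanced {fuel : ℕ}
    (recurse : ∀ {s e gs} → Context s e gs → length gs ≤ 5 * ω → e ≤ s + fuel → SegmentColouring s e gs)
    (old : List Group) where

    -- The bound on `length gs` keeps a class free at every node; the one on `seen` charges each new
    -- group to a level. The last two hypotheses ensure that a piece reaches `recurse` only after it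
    -- has become shorter than the original segment.
    build : ∀ levels {s e gs pivots} → Context s e gs → length gs + levels ≤ 7 * ω →
      (∀ x y → seen gs x y + levels ≤ seen old x y + 2 * ω) →
      Cuts old s e pivots → length pivots < 2 ^ levels →
      e ≤ s + suc fuel → (pivots ≡ [] → e ≤ s + fuel) → SegmentColouring s e gs
    build levels {s} {e} {gs} ctx _ gs-seen (done (inj₁ few)) _ _ small =
      extend (recurse (Context-filter (touches? s e) ctx) (begin
        seen gs s e               ≤⟨ m≤m+n _ levels ⟩
        seen gs s e + levels      ≤⟨ gs-seen s e ⟩
        seen old s e + 2 * ω      ≤⟨ +-monoˡ-≤ (2 * ω) few ⟩
        3 * ω + 2 * ω             ≡⟨ *-distribʳ-+ ω 3 2 ⟨
        5 * ω                     ∎) (small refl))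
      where open ≤-Reasoning
    build _ _ _ _ (done (inj₂ e≤)) _ _ _ = short e≤
    build zero _ _ _ (cut _ _ _ _) (s≤s ()) _ _
    build (suc levels) {s} {e} {gs} {pivots} ctx gs≤ gs-seen cuts@(cut _ _ _ _) pivots< e≤ small
      -- The left part takes exactly as many pivots as `levels` levels can hold; if there are no
      -- more than that in all, a level is skipped.
      with splitAt-or-short (pred (2 ^ levels)) pivots
    ... | inj₁ pivots≤ = build levels ctx
      (≤-trans (+-monoʳ-≤ (length gs) (n≤1+n levels)) gs≤)
      (λ x y → ≤-trans (+-monoʳ-≤ (seen gs x y) (n≤1+n levels)) (gs-seen x y))
      cuts (≤pred⇒< pivots≤) e≤ small
      where
      ≤pred⇒< : ∀ {k} → k ≤ pred (2 ^ levels) → k < 2 ^ levels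
      ≤pred⇒< k≤ = subst (_ <_) (suc-pred (2 ^ levels) {{m^n≢0 2 levels}}) (s≤s k≤)
    ... | inj₂ (ps , p , qs , eq , ps≡ , pivots≡)
      with s<p , p<e , cutsˡ , cutsʳ ← Cuts-++⁻ ps (subst (Cuts old s e) eq cuts)
      with c , fresh ← fresh-class gs (≤-trans (m<m+n (length gs) z<s) gs≤)
      = node c fresh
        (build levels (Context-left (<⇒≤ p<e) ctx)
          (subst (_≤ 7 * ω) (trans (+-suc (length gs) levels)
            (sym (cong (_+ levels) (trans (length-++ gs) (+-comm (length gs) 1))))) gs≤)
          (λ x y → one-more (seen-∷ʳ (group s p e c) gs x y) (gs-seen x y))
          cutsˡ (subst (_< 2 ^ levels) (sym ps≡) m<) (≤-trans p≤ (+-monoʳ-≤ s (n≤1+n fuel))) (λ _ → p≤))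
        (build levels (Context-right (<⇒≤ s<p) ctx)
          (subst (_≤ 7 * ω) (+-suc (length gs) levels) gs≤)
          (λ x y → one-more (seen-∷ (group s p e c) gs x y) (gs-seen x y))
          cutsʳ qs< (≤-trans e≤p (+-monoʳ-≤ p (n≤1+n fuel))) (λ _ → e≤p))
      where
      m = pred (2 ^ levels)
      suc-m : suc m ≡ 2 ^ levels
      suc-m = suc-pred (2 ^ levels) {{m^n≢0 2 levels}}
      m< : m < 2 ^ levels
      m< = ≤-reflexive suc-m
      one-more : ∀ {i j k} → i ≤ suc j → j + suc levels ≤ k → i + levels ≤ k
      one-more {_} {j} i≤ j≤ = ≤-trans (+-monoˡ-≤ levels i≤) (≤-trans (≤-reflexive (sym (+-suc j levels))) j≤)
      qs< : length qs < 2 ^ levels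
      qs< = +-cancelˡ-< (suc m) (length qs) (2 ^ levels) (subst₂ _<_ pivots≡
        (cong₂ _+_ (sym suc-m) (+-identityʳ (2 ^ levels))) pivots<)
      p≤ : p ≤ s + fuel
      p≤ = s≤s⁻¹ (≤-trans p<e (subst (e ≤_) (+-suc s fuel) e≤))
      e≤p : e ≤ p + fuel
      e≤p = ≤-trans e≤ (subst (_≤ p + fuel) (sym (+-suc s fuel)) (+-monoˡ-≤ fuel s<p))

  colour-segment : ∀ fuel {s e gs} → Context s e gs → length gs ≤ 5 * ω → e ≤ s + fuel →
    SegmentColouring s e gs
  colour-segment zero {s} _ _ e≤ = short (≤-trans e≤ (≤-trans (≤-reflexive (+-identityʳ s)) (n≤1+n s)))
  colour-segment (suc fuel) {s} {e} {gs} ctx gs≤ e≤ with suc s <? e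
  ... | no s≮e = short (≮⇒≥ s≮e)
  ... | yes s<e = Balanced.build (colour-segment fuel) gs (2 * ω) ctx
      (≤-trans (+-monoˡ-≤ (2 * ω) gs≤) (≤-reflexive (sym (*-distribʳ-+ ω 5 2))))
      (λ _ _ → ≤-refl)
      -- This forced cut makes every piece strictly shorter than the segment, even if the sweep
      -- makes no cut.
      (cut ≤-refl s<e (inj₂ ≤-refl) (Sweep.cuts sw))
      (few-cuts (Context-mono (n≤1+n s) ≤-refl ctx) gs≤ sw) e≤ (λ ())
    where
    sw : Sweep gs (suc s) e
    sw = sweep gs (e ∸ suc (suc s)) (suc s) (suc (suc s)) (m+[n∸m]≡n s<e) ≤-refl (inj₂ ≤-refl)

  module _ {bound : ℕ} (hi<bound : ∀ v → hi v < bound) where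

    colouring : ∃[ f ] (∀ {u v : V} → Adj u v → f u ≢ (Fin (7 * ω * (ω * (ω * ω))) ∋ f v))
    colouring = (λ v → combine (proj₁ (colour c v)) (proj₂ (colour c v))) , λ {u} {v} adj eq →
      let eq₁ , eq₂ = Fin.combine-injective (proj₁ (colour c u)) _ (proj₁ (colour c v)) _ eq in
      proper c (z≤n , hi<bound u) (z≤n , hi<bound v) adj (cong₂ _,_ eq₁ eq₂)
      where
      c : SegmentColouring 0 bound []
      c = colour-segment bound ([] , []) z≤n ≤-refl

-- The order of the corners is not decidable; but the claimed inequality is, so
-- finitely many comparisons may be decided under a double negation.
¬¬-∀ : ∀ n {P : Fin n → Set p} → (∀ i → ¬ ¬ P i) → ¬ ¬ (∀ i → P i)
¬¬-∀ zero    ¬¬P k = k λ ()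
¬¬-∀ (suc n) ¬¬P k = ¬¬P zero λ p₀ → ¬¬-∀ n (¬¬P ∘ suc) λ ps → k λ where
  zero    → p₀
  (suc i) → ps i

-- From polygons to arrangements

module Rank {A : Set a} {_≺_ : Rel A r} {_~_ : Rel A s}
  (≺-irrefl : Irreflexive _~_ _≺_) (≺-trans : Transitive _≺_)
  (~-refl : ∀ {x} → x ~ x) (~-sym : Symmetric _~_) (≺-respʳ-~ : _≺_ Respectsʳ _~_)
  (compare : ∀ x y → x ≺ y ⊎ x ~ y ⊎ y ≺ x)
  (xs : List A) (complete : ∀ x → x ∈ xs) where

  _≺?_ : ∀ x y → Dec (x ≺ y)
  x ≺? y with compare x y
  ... | inj₁ x≺y        = yes x≺y
  ... | inj₂ (inj₁ x~y) = no (≺-irrefl x~y)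
  ... | inj₂ (inj₂ y≺x) = no (≺-irrefl ~-refl ∘ ≺-trans y≺x)

  -- Counting only strict predecessors gives equivalent elements the same number, so coinciding
  -- corners become one position.
  rank : A → ℕ
  rank y = length (filter (_≺? y) xs)

  rank-mono : ∀ {x y} → x ≺ y → rank x < rank y
  rank-mono {x} {y} x≺y = filter-mono-< (_≺? x) (_≺? y) (λ _ z≺x → ≺-trans z≺x x≺y)
    (complete x) (≺-irrefl ~-refl) x≺y

  rank-cong-≤ : ∀ {x y} → x ~ y → rank x ≤ rank y
  rank-cong-≤ {x} {y} x~y = filter-mono-≤ (_≺? x) (_≺? y) xs (λ _ → ≺-respʳ-~ x~y)

  rank-cancel-< : ∀ {x y} → rank x < rank y → x ≺ y
  rank-cancel-< {x} {y} rx<ry with compare x y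
  ... | inj₁ x≺y        = x≺y
  ... | inj₂ (inj₁ x~y) = contradiction (rank-cong-≤ (~-sym x~y)) (<⇒≱ rx<ry)
  ... | inj₂ (inj₂ y≺x) = contradiction (rank-mono y≺x) (<-asym rx<ry)

  rank-injective : ∀ {x y} → rank x ≡ rank y → x ~ y
  rank-injective {x} {y} eq with compare x y
  ... | inj₁ x≺y        = contradiction eq (<⇒≢ (rank-mono x≺y))
  ... | inj₂ (inj₁ x~y) = x~y
  ... | inj₂ (inj₂ y≺x) = contradiction (sym eq) (<⇒≢ (rank-mono y≺x))

module _ {n a} (G : Graph n a) where
  open Graph G

  -- Irreflexivity rules out repetitions, so each vertex of the list enlarges the subset.
  clique-length≤ : ∀ {ω} → (∀ S → IsClique G S → ∣ S ∣ ≤ ω) → ∀ {vs} → AllPairs Adjacent vs → length vs ≤ ω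
  clique-length≤ bound {vs} adj = ≤-trans (length≤ adj) (bound (fromList vs) λ u∈ v∈ u≢v →
    [ id , symmetric ]′ (AllPairs-compare adj (∈⁻ vs u∈) (∈⁻ vs v∈) u≢v))
    where
    fromList : List (Fin n) → Subset n
    fromList = foldr (λ v S → ⁅ v ⁆ ∪ S) Subset.⊥
    ∈⁻ : ∀ vs {v} → v Subset.∈ fromList vs → v ∈ vs
    ∈⁻ []       v∈ = contradiction v∈ Subset.∉⊥
    ∈⁻ (u ∷ vs) v∈ with Subset.x∈p∪q⁻ ⁅ u ⁆ (fromList vs) v∈
    ... | inj₁ v∈u = here (Subset.x∈⁅y⁆⇒x≡y u v∈u)
    ... | inj₂ v∈  = there (∈⁻ vs v∈)
    length≤ : ∀ {vs} → AllPairs Adjacent vs → length vs ≤ ∣ fromList vs ∣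
    length≤ []                     = z≤n
    length≤ {v ∷ vs} (adj-v ∷ adj) = ≤-<-trans (length≤ adj) (Subset.p⊂q⇒∣p∣<∣q∣
      ( Subset.q⊆p∪q ⁅ v ⁆ (fromList vs)
      , v , Subset.x∈p∪q⁺ (inj₁ (Subset.x∈⁅x⁆ v))
      , λ v∈ → irreflexive refl (All.lookup adj-v (∈⁻ vs v∈))))

module PolygonArrangement {c ℓ₁ ℓ₂ a} (ℝ : RealNumbers c ℓ₁ ℓ₂) {n} (G : Graph n a)
  (pcg : IsPolygonCircleGraph G ℝ) where
  open RealNumbers ℝ using (0#) renaming (_<_ to _<ᴿ_; refl to ≈-refl; sym to ≈-sym; trans to ≈-trans)
  open OrderedField ℝ using (<-respʳ-≈; 0<-x⇒x<0) renaming (<-irrefl to <ᴿ-irrefl; <-asym to <ᴿ-asym)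
  open Plane ℝ
  open CircleGeometry ℝ
  open CircleOrder ℝ
  open Graph G renaming (Adjacent to Adj)
  open IsPolygonCircleGraph pcg using (polygon; adjacent)

  Corner : Set
  Corner = Σ[ v ∈ Fin n ] Fin (InscribedPolygon.size (polygon v))

  point : Corner → Point
  point (v , i) = InscribedPolygon.corner (polygon v) i

  module _ (key : Corner → Key) (hasKey : ∀ x → HasKey (point x) (key x))
    (compare : ∀ x y → key x ≺ key y ⊎ key x ~ key y ⊎ key y ≺ key x)
    {ω} (bound : ∀ S → IsClique G S → ∣ S ∣ ≤ ω) where

    private
      V = Fin n

      corner-list : List Corner
      corner-list = concat (tabulate λ v → tabulate λ i → v , i)

      corner-list-complete : ∀ x → x ∈ corner-list
      corner-list-complete (v , i) = ∈-concat⁺′ (∈-tabulate⁺ i) (∈-tabulate⁺ v)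

      open Rank {_≺_ = λ x y → key x ≺ key y} {_~_ = λ x y → key x ~ key y}
        ≺-irrefl ≺-trans ~-refl ~-sym ≺-respʳ-~ compare corner-list corner-list-complete

      corners : V → List ℕ
      corners v = tabulate λ i → rank (v , i)

      corner₀ corner₁ : ∀ v → Fin (InscribedPolygon.size (polygon v))
      corner₀ v = fromℕ< (≤-trans (s≤s z≤n) (InscribedPolygon.size≥3 (polygon v)))
      corner₁ v = fromℕ< (≤-trans (s≤s (s≤s z≤n)) (InscribedPolygon.size≥3 (polygon v)))

      lo hi : V → ℕ
      -- The default value is itself the rank of a corner of `v`, so the extremum is attained in
      -- `corners v`.
      lo v = min (rank (v , corner₀ v)) (corners v)
      hi v = max (rank (v , corner₀ v)) (corners v)

      lo∈ : ∀ v → lo v ∈ corners v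
      lo∈ v = argmin-all id {P = _∈ corners v} (∈-tabulate⁺ (corner₀ v)) (All.tabulate id)

      hi∈ : ∀ v → hi v ∈ corners v
      hi∈ v = argmax-all id {P = _∈ corners v} (∈-tabulate⁺ (corner₀ v)) (All.tabulate id)

      lo≤ : ∀ {v x} → x ∈ corners v → lo v ≤ x
      lo≤ {v} = All.lookup (min≤xs (rank (v , corner₀ v)) (corners v))

      ≤hi : ∀ {v x} → x ∈ corners v → x ≤ hi v
      ≤hi {v} = All.lookup (xs≤max (rank (v , corner₀ v)) (corners v))

      same-point : ∀ {x y} → rank x ≡ rank y → point x ≈ₚ point y
      same-point {x} {y} eq = key-injective (hasKey x) (hasKey y) (rank-injective eq)

      orient-sorted : ∀ x y z → rank x < rank y → rank y < rank z → 0# <ᴿ orient (point x) (point y) (point z)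
      orient-sorted x y z x<y y<z =
        orient-pos (hasKey x) (hasKey y) (hasKey z) (rank-cancel-< x<y) (rank-cancel-< y<z)

      -- Two different corners are different points, so their ranks differ.
      lo<hi : ∀ v → lo v < hi v
      lo<hi v = case <-cmp (rank (v , corner₀ v)) (rank (v , corner₁ v)) of λ where
        (tri< r₀<r₁ _ _) → ≤-<-trans (lo≤ (∈-tabulate⁺ (corner₀ v))) (<-≤-trans r₀<r₁ (≤hi (∈-tabulate⁺ (corner₁ v))))
        (tri≈ _ r₀≡r₁ _) → contradiction
          (Fin.fromℕ<-injective 0 1 _ _ (InscribedPolygon.distinct (polygon v) (same-point r₀≡r₁))) λ ()
        (tri> _ _ r₁<r₀) → ≤-<-trans (lo≤ (∈-tabulate⁺ (corner₁ v))) (<-≤-trans r₁<r₀ (≤hi (∈-tabulate⁺ (corner₀ v))))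

      share : ∀ {u v x} → u ≢ v → x ∈ corners u → x ∈ corners v → Adj u v
      share {u} {v} u≢v x∈u x∈v
        with i , refl ← ∈-tabulate⁻ {f = λ i → rank (u , i)} x∈u
        with j , eq ← ∈-tabulate⁻ {f = λ j → rank (v , j)} x∈v =
        Equivalence.from (adjacent u≢v) (shared-corner i j (same-point eq))

      -- Increasing rank is counterclockwise order, so the four corners span a convex quadrilateral
      -- with one diagonal in each polygon.
      cross : ∀ {u v w x y z} → u ≢ v → w < x → x < y → y < z →
        w ∈ corners u → x ∈ corners v → y ∈ corners u → z ∈ corners v → Adj u v
      cross {u} {v} u≢v w<x x<y y<z w∈ x∈ y∈ z∈
        with i , refl ← ∈-tabulate⁻ {f = λ i → rank (u , i)} w∈
        with j , refl ← ∈-tabulate⁻ {f = λ j → rank (v , j)} x∈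
        with k , refl ← ∈-tabulate⁻ {f = λ i → rank (u , i)} y∈
        with l , refl ← ∈-tabulate⁻ {f = λ j → rank (v , j)} z∈ =
        Equivalence.from (adjacent u≢v) (crossing-corners i k j l
          (orient-sorted (u , i) (v , j) (u , k) w<x x<y)
          (orient-sorted (u , i) (v , j) (v , l) w<x (<-trans x<y y<z))
          (orient-sorted (u , i) (u , k) (v , l) (<-trans w<x x<y) y<z)
          (orient-sorted (v , j) (u , k) (v , l) x<y y<z))

      -- Otherwise the chord from the first to the last corner of u separates
      -- the two polygons.
      meets : ∀ {u v} → Adj u v → ∃[ x ] x ∈ corners v × lo u ≤ x × x ≤ hi u
      meets {u} {v} adj with Fin.any? (λ j → (lo u ≤? rank (v , j)) ×-dec (rank (v , j) ≤? hi u))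
      ... | yes (j , lo≤r , r≤hi) = rank (v , j) , ∈-tabulate⁺ j , lo≤r , r≤hi
      ... | no none
        with l , lo≡ ← ∈-tabulate⁻ {f = λ i → rank (u , i)} (lo∈ u)
        with h , hi≡ ← ∈-tabulate⁻ {f = λ i → rank (u , i)} (hi∈ u) =
        contradiction (Equivalence.to (adjacent (λ u≡v → irreflexive u≡v adj)) adj)
          (separated pₗ pₕ inner outer)
        where
        pₗ = point (u , l)
        pₕ = point (u , h)
        l<h : rank (u , l) < rank (u , h)
        l<h = subst₂ _<_ lo≡ hi≡ (lo<hi u)

        -- A corner of `u` is an end of the chord, with orientation 0, or lies strictly between the
        -- ends in rank, with negative orientation.
        inner : ∀ i → ¬ 0# <ᴿ orient pₗ pₕ (point (u , i))
        inner i 0<o with m≤n⇒m<n∨m≡n (lo≤ {u} (∈-tabulate⁺ i)) | m≤n⇒m<n∨m≡n (≤hi {u} (∈-tabulate⁺ i))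
        ... | inj₂ lo≡r | _ = <ᴿ-irrefl (≈-sym (≈-trans
          (orient-cong (≈-refl , ≈-refl) (≈-refl , ≈-refl) (same-point (trans (sym lo≡r) lo≡)))
          (orient-repeat pₗ pₕ))) 0<o
        ... | inj₁ _ | inj₂ r≡hi = <ᴿ-irrefl (≈-sym (≈-trans (orient-cycle pₗ pₕ (point (u , i))) (≈-trans
          (orient-cong (≈-refl , ≈-refl) (same-point (trans r≡hi hi≡)) (≈-refl , ≈-refl))
          (≈-trans (orient-cycle pₕ pₕ pₗ) (orient-repeat pₕ pₗ))))) 0<o
        ... | inj₁ lo<r | inj₁ r<hi = <ᴿ-asym 0<o (0<-x⇒x<0 (<-respʳ-≈ (orient-swap pₗ (point (u , i)) pₕ)
          (orient-sorted (u , l) (u , i) (u , h) (subst (_< _) lo≡ lo<r) (subst (_ <_) hi≡ r<hi))))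

        -- In cyclic order every corner of `v` comes after `pₕ` and before `pₗ`.
        outer : ∀ j → 0# <ᴿ orient pₗ pₕ (point (v , j))
        outer j with rank (v , j) <? lo u | hi u <? rank (v , j)
        ... | yes r<lo | _ = <-respʳ-≈ (orient-cycle (point (v , j)) pₗ pₕ)
          (orient-sorted (v , j) (u , l) (u , h) (subst (_ <_) lo≡ r<lo) l<h)
        ... | no _ | yes hi<r = orient-sorted (u , l) (u , h) (v , j) l<h (subst (_< _) hi≡ hi<r)
        ... | no r≮lo | no hi≮r = contradiction (j , ≮⇒≥ r≮lo , ≮⇒≥ hi≮r) none

    arrangement : Arrangement Adj ω
    arrangement = record
      { adj-sym = symmetric
      ; adj⇒≢   = λ adj u≡v → irreflexive u≡v adj
      ; corners = corners
      ; lo      = lo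
      ; hi      = hi
      ; lo∈     = lo∈
      ; hi∈     = hi∈
      ; lo≤     = lo≤
      ; ≤hi     = ≤hi
      ; lo<hi   = lo<hi
      ; share   = share
      ; cross   = cross
      ; meets   = meets
      ; clique≤ = clique-length≤ G bound
      }

  ¬¬-arrangement : ∀ {ω} → (∀ S → IsClique G S → ∣ S ∣ ≤ ω) → ¬ ¬ Arrangement Adj ω
  ¬¬-arrangement bound ¬arrangement =
    ¬¬-∀ n (λ v → ¬¬-∀ _ λ i → has-key (InscribedPolygon.onCircle (polygon v) i)) λ keys →
    let key : Corner → Key
        key (v , i) = proj₁ (keys v i)
    in
    ¬¬-∀ n (λ u → ¬¬-∀ _ λ i → ¬¬-∀ n λ v → ¬¬-∀ _ λ j → ≺-compare (key (u , i)) (key (v , j))) λ compare →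
    ¬arrangement (arrangement key (λ (v , i) → proj₂ (keys v i)) (λ (u , i) (v , j) → compare u i v j) bound)

corollary3 : ∀ {c ℓ₁ ℓ₂ a} (ℝ : RealNumbers c ℓ₁ ℓ₂) {n : ℕ} (G : Graph n a) →
    IsPolygonCircleGraph G ℝ →
    ∀ {ω χ : ℕ} → IsCliqueNumber G ω → IsChromaticNumber G χ → χ ≤ 7 * ω ^ 4
corollary3 ℝ {zero} G _ _ (_ , χ≤) = ≤-trans (χ≤ 0 ((λ ()) , λ { {()} })) z≤n
corollary3 ℝ {suc n} G pcg {ω} {χ} (_ , bound) (_ , χ≤) =
  decidable-stable (χ ≤? 7 * ω ^ 4) λ χ≰ → PolygonArrangement.¬¬-arrangement ℝ G pcg bound λ M →
    -- A single vertex is a clique, whence `1 ≤ ω`.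
    χ≰ (colour M (≤-trans (s≤s z≤n) (Arrangement.clique≤ M {vs = zero ∷ []} ([] ∷ []))))
  where
  exponent : ∀ ω → 7 * ω * (ω * (ω * ω)) ≡ 7 * (ω * (ω * (ω * (ω * 1))))
  exponent = solve-∀

  colour : Arrangement (Graph.Adjacent G) ω → 1 ≤ ω → χ ≤ 7 * ω ^ 4
  colour M 1≤ω = subst (χ ≤_) (exponent ω) (χ≤ _ (PillarColouring.colouring M {{>-nonZero 1≤ω}}
    (fromℕ< {0} (≤-trans 1≤ω (m≤n*m ω 7)))
    -- The whole line ends one position after the largest `hi v`.
    (λ v → s≤s (All.lookup (xs≤max 0 (tabulate (Arrangement.hi M))) (∈-tabulate⁺ {f = Arrangement.hi M} v)))))
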